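{- For every integer $n\ge 0$ let \[ W_n=\sum_{k=0}^{\lfloor n/2\rfloor}\binom{n}{2k}\frac{\binom{2k}{k}}{2k-1}. \] Then: (i) For every positive integer $n$, \[ \sum_{k=0}^{n-1}(8k+9)W_k^2\equiv n \pmod{2n}. \] (ii) For every odd prime $p$, \[ \frac{1}{p}\sum_{k=0}^{p-1}(8k+9)W_k^2\equiv 24+10\left(\frac{ -1}{p}\right)-9\left(\frac{p}{3}\right)-18\left(\frac{3}{p}\right)\pmod{p}. \]
   Context: Each $W_n$ is an integer. $\left(\frac{\cdot}{\cdot}\right)$ denotes the Legendre symbol (with $\left(\frac{p}{3}\right)=0$ when $p=3$ and $\left(\frac{3}{p}\right)=0$ when $p=3$). -}

module Defs where

open import Data.Nat as ℕ using (ℕ; zero; suc)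
open import Data.Nat.DivMod as ℕD using ()
open import Data.Nat.Combinatorics using (_C_)
open import Data.Integer as ℤ using (ℤ; +_; -_; _-_; _*_; ∣_∣)
import Data.Nat.Divisibility as ℕDiv
open import Data.Integer.Divisibility using (_∣_)
open import Data.List using (List; upTo; map; foldr)
open import Data.List.Relation.Unary.Any using (any?)
open import Relation.Nullary using (Dec; yes; no)

_∣ℤ?_ : (m n : ℤ) → Dec (m ∣ n)
m ∣ℤ? n = ∣ m ∣ ℕDiv.∣? ∣ n ∣

sumℤ : List ℤ → ℤ
sumℤ = foldr ℤ._+_ (+ 0)

_≡_[mod_] : ℤ → ℤ → ℤ → Set
a ≡ b [mod m ] = m ∣ (a - b)

-- the k-th summand  binom(2k,k)/(2k-1)  (an exact integer):
-- k = 0 : 1/(-1) = -1 ;  k ≥ 1 : 2k-1 = suc (2(k-1)) > 0 and the division is exact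
ratio : ℕ → ℤ
ratio zero    = - (+ 1)
ratio (suc j) = + (((2 ℕ.* suc j) C (suc j)) ℕD./ suc (2 ℕ.* j))

W : ℕ → ℤ
W n = sumℤ (map (λ k → + (n C (2 ℕ.* k)) * ratio k) (upTo (suc (n ℕD./ 2))))

S : ℕ → ℤ
S n = sumℤ (map (λ k → + (8 ℕ.* k ℕ.+ 9) * (W k * W k)) (upTo n))

legendre : ℤ → ℕ → ℤ
legendre a p with (+ p) ∣ℤ? a
... | yes _ = + 0
... | no  _ with any? (λ x → (+ p) ∣ℤ? ((+ x) * (+ x) - a)) (upTo p)
...   | yes _ = + 1
...   | no  _ = - (+ 1)

{-# OPTIONS --safe #-}

-- W is the binomial transform of the sequence φ with φ(2k) = C(2k,k)/(2k-1) and φ(odd) = 0, so that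
-- the recurrence j φ(j) = 4 (j-3) φ(j-2) becomes a third-order recurrence for W:  with
-- Z(n+1) = (n+1) (W(n+1) - 3 W(n)) it reads  Z(n+2) - Z(n) = -2 (W(n+1) + 3 W(n)), which makes
--   2 S(n+1) = 18 (n+1) W(n)² + Z(n) Z(n+1)
-- telescope.  Part (i) follows since W is odd and Z even.  For p = 2m+1, a binomial transform at p
-- reduces to its two extreme terms modulo p, which gives W(p), W(p+1), Z(p-1), and
-- W(p-1) ≡ ∑_{k≤m} ratio k ≡ 3 (-3)^m - 4 (-1)^m because ratio k ≡ -(-4)^k C(m+1,k).
-- The powers are Legendre symbols by Euler's criterion and by reading (1-ω)^p modulo p.

module Submission where

open import Defs
open import Data.Nat as ℕ using (ℕ; zero; suc; z≤n; s≤s)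
open import Data.Nat.Primality using (Prime; euclidsLemma; prime?; prime⇒irreducible)
open import Data.Integer as ℤ using (ℤ; +_; -[1+_]; -_; _+_; _-_; _*_; _^_; ∣_∣)
open import Data.Product using (_×_; _,_; ∃-syntax)
open import Relation.Binary.PropositionalEquality using (_≡_; _≢_; refl; sym; trans; cong; cong₂; subst; module ≡-Reasoning)

open import Data.Empty using (⊥-elim)
import Data.Integer.Divisibility.Signed as Signed
import Data.Integer.Properties as ℤP
open import Data.Integer.Tactic.RingSolver using (solve-∀)
open import Data.List using (upTo; applyUpTo)
open import Data.List.Membership.Propositional using (lose)
open import Data.List.Membership.Propositional.Properties using (∈-upTo⁺)
open import Data.List.Properties using (map-upTo)
open import Data.List.Relation.Unary.Any using (any?; satisfied)
open import Data.Nat.Combinatorics using (_C_; nCk+nC[k+1]≡[n+1]C[k+1]; nCk≡nC[n∸k]; nCn≡1; nC1≡n)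
open import Data.Nat.Coprimality using (Coprime; coprime-divisor)
import Data.Nat.Divisibility as ℕDiv
import Data.Nat.DivMod as ℕD
import Data.Nat.Properties as ℕP
import Data.Nat.Tactic.RingSolver as ℕR
open import Data.Sum using (_⊎_; inj₁; inj₂; [_,_]′)
open import Function using (_∘_)
open import Relation.Binary.Bundles using (Setoid)
import Relation.Binary.Reasoning.Setoid as SetoidReasoning
open import Relation.Nullary using (¬_; yes; no)
open import Relation.Nullary.Decidable using (from-yes; from-no)
open import Algebra.Properties.AbelianGroup ℤP.+-0-abelianGroup using (∙-cancelˡ)
open import Algebra.Properties.CommutativeSemigroup ℤP.+-commutativeSemigroup using (interchange)

-- Since Z(n+1) is a multiple of n+1, the closed form can be divided by n+1 over the integers: the
-- quotient q of S(n+1) by n+1 satisfies 2q = 18 W(n)² + X(n) Z(n), where X(n) = W(n+1) - 3 W(n).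
-- This one identity serves both parts. Its parity gives (i); at n = p-1 it turns a claim modulo p²
-- into one modulo p, so that only residues of `W` and `Z` near p are needed. The symbol (p/3)
-- appears without quadratic reciprocity. Because (1-ω)² = -3ω, the power (1-ω)^p contains (-3)^m,
-- whereas modulo p it equals 1 - ω^p, which depends only on p modulo 3. The symbols of -1 and 3 are
-- left to Euler's criterion, and the identity 3^m = (-1)^m (-3)^m links the three powers.

module _ where

  open ≡-Reasoning

  -- Finite sums and the binomial transform

  ∑ : (ℕ → ℤ) → ℕ → ℤ
  ∑ f n = sumℤ (applyUpTo f n)

  ∑-ext : ∀ {f g} n → (∀ k → f k ≡ g k) → ∑ f n ≡ ∑ g n
  ∑-ext zero    h = refl
  ∑-ext (suc n) h = cong₂ _+_ (h 0) (∑-ext n (h ∘ suc))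

  ∑-snoc : ∀ f n → ∑ f (suc n) ≡ ∑ f n + f n
  ∑-snoc f zero    = ℤP.+-comm (f 0) (+ 0)
  ∑-snoc f (suc n) = begin
    f 0 + ∑ (f ∘ suc) (suc n)             ≡⟨ cong (_+_ (f 0)) (∑-snoc (f ∘ suc) n) ⟩
    f 0 + (∑ (f ∘ suc) n + f (suc n))     ≡⟨ ℤP.+-assoc (f 0) _ _ ⟨
    ∑ f (suc n) + f (suc n)               ∎

  ∑-+ : ∀ f g n → ∑ (λ k → f k + g k) n ≡ ∑ f n + ∑ g n
  ∑-+ f g zero    = refl
  ∑-+ f g (suc n) = trans (cong (_+_ (f 0 + g 0)) (∑-+ (f ∘ suc) (g ∘ suc) n)) (interchange (f 0) (g 0) _ _)

  ∑-neg : ∀ f n → ∑ (λ k → - f k) n ≡ - ∑ f n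
  ∑-neg f zero    = refl
  ∑-neg f (suc n) = trans (cong (_+_ (- f 0)) (∑-neg (f ∘ suc) n)) (sym (ℤP.neg-distrib-+ (f 0) _))

  ∑-zero : ∀ f n → ∑ (λ k → + 0 * f k) n ≡ + 0
  ∑-zero f zero    = refl
  ∑-zero f (suc n) = trans (ℤP.+-identityˡ _) (∑-zero (f ∘ suc) n)

  -- The binomial transform ∑ⱼ C(n,j) f(j), computed by Pascal's rule.
  B : (ℕ → ℤ) → ℕ → ℤ
  B f zero    = f 0
  B f (suc n) = B f n + B (f ∘ suc) n

  B-ext : ∀ {f g} n → (∀ k → f k ≡ g k) → B f n ≡ B g n
  B-ext zero    h = h 0
  B-ext (suc n) h = cong₂ _+_ (B-ext n h) (B-ext n (h ∘ suc))

  B-+ : ∀ f g n → B (λ k → f k + g k) n ≡ B f n + B g n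
  B-+ f g zero    = refl
  B-+ f g (suc n) = trans (cong₂ _+_ (B-+ f g n) (B-+ (f ∘ suc) (g ∘ suc) n)) (interchange (B f n) (B g n) _ _)

  B-* : ∀ c f n → B (λ k → c * f k) n ≡ c * B f n
  B-* c f zero    = refl
  B-* c f (suc n) = trans (cong₂ _+_ (B-* c f n) (B-* c (f ∘ suc) n))
                          (sym (ℤP.*-distribˡ-+ c (B f n) _))

  -- The transform version of j C(n+1,j) = (n+1) C(n,j-1).
  B-j* : ∀ f n → B (λ j → + j * f j) (suc n) ≡ + suc n * B (f ∘ suc) n
  B-j* f zero    = lemma (f 0) (f 1)
    where
    lemma : ∀ a b → + 0 * a + + 1 * b ≡ + 1 * b
    lemma = solve-∀
  B-j* f (suc n) = begin
    B (λ j → + j * f j) (suc n) + B (λ j → + suc j * f (suc j)) (suc n)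
      ≡⟨ cong₂ _+_ (B-j* f n) (B-ext (suc n) λ j → lemma₁ (+ j) (f (suc j))) ⟩
    + suc n * B f′ n + B (λ j → + j * f′ j + f′ j) (suc n)
      ≡⟨ cong (_+_ (+ suc n * B f′ n)) (B-+ (λ j → + j * f′ j) f′ (suc n)) ⟩
    + suc n * B f′ n + (B (λ j → + j * f′ j) (suc n) + B f′ (suc n))
      ≡⟨ cong (λ x → + suc n * B f′ n + (x + B f′ (suc n))) (B-j* f′ n) ⟩
    + suc n * B f′ n + (+ suc n * B (f′ ∘ suc) n + (B f′ n + B (f′ ∘ suc) n))
      ≡⟨ lemma₂ (+ suc n) (B f′ n) (B (f′ ∘ suc) n) ⟩
    + suc (suc n) * (B f′ n + B (f′ ∘ suc) n) ∎
    where
    f′ = f ∘ suc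
    lemma₁ : ∀ j x → (+ 1 + j) * x ≡ j * x + x
    lemma₁ = solve-∀
    lemma₂ : ∀ n a b → n * a + (n * b + (a + b)) ≡ (+ 1 + n) * (a + b)
    lemma₂ = solve-∀

  -- Any number of terms above n is allowed, because the further binomials vanish. The induction
  -- uses this freedom, its two hypotheses having lengths `suc m` and `m`, and so does `W≡B`, where
  -- the length is even.
  B-∑ : ∀ f {n m} → n ℕ.< m → B f n ≡ ∑ (λ j → + (n C j) * f j) m
  B-∑ f {zero}  {suc m} _ = begin
    f 0                                        ≡⟨ lemma (f 0) ⟩
    + 1 * f 0 + + 0                            ≡⟨ cong (_+_ (+ 1 * f 0)) (∑-zero (f ∘ suc) m) ⟨
    + 1 * f 0 + ∑ (λ j → + 0 * f (suc j)) m    ∎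
    where
    lemma : ∀ a → a ≡ + 1 * a + + 0
    lemma = solve-∀
  B-∑ f {suc n} {suc m} (s≤s n<m) = begin
    B f n + B (f ∘ suc) n
      ≡⟨ cong₂ _+_ (B-∑ f (ℕP.m<n⇒m<1+n n<m)) (B-∑ (f ∘ suc) n<m) ⟩
    (+ 1 * f 0 + ∑ (λ j → + (n C suc j) * f (suc j)) m) + ∑ (λ j → + (n C j) * f (suc j)) m
      ≡⟨ lemma₁ (+ 1 * f 0) _ _ ⟩
    + 1 * f 0 + (∑ (λ j → + (n C j) * f (suc j)) m + ∑ (λ j → + (n C suc j) * f (suc j)) m)
      ≡⟨ cong (_+_ (+ 1 * f 0)) (∑-+ (λ j → + (n C j) * f (suc j)) (λ j → + (n C suc j) * f (suc j)) m) ⟨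
    + 1 * f 0 + ∑ (λ j → + (n C j) * f (suc j) + + (n C suc j) * f (suc j)) m
      ≡⟨ cong (_+_ (+ 1 * f 0)) (∑-ext m λ j → pascal j) ⟩
    + 1 * f 0 + ∑ (λ j → + (suc n C suc j) * f (suc j)) m ∎
    where
    lemma₁ : ∀ a x y → (a + x) + y ≡ a + (y + x)
    lemma₁ = solve-∀
    pascal : ∀ j → + (n C j) * f (suc j) + + (n C suc j) * f (suc j) ≡ + (suc n C suc j) * f (suc j)
    pascal j = begin
      + (n C j) * f (suc j) + + (n C suc j) * f (suc j)   ≡⟨ ℤP.*-distribʳ-+ (f (suc j)) (+ (n C j)) (+ (n C suc j)) ⟨
      + (n C j ℕ.+ n C suc j) * f (suc j)                 ≡⟨ cong (λ x → + x * f (suc j)) (nCk+nC[k+1]≡[n+1]C[k+1] n j) ⟩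
      + (suc n C suc j) * f (suc j)                       ∎

  spread : (ℕ → ℤ) → ℕ → ℤ
  spread r zero          = r 0
  spread r (suc zero)    = + 0
  spread r (suc (suc j)) = spread (r ∘ suc) j

  2*suc : ∀ k → 2 ℕ.* suc k ≡ suc (suc (2 ℕ.* k))
  2*suc k = ℕP.*-suc 2 k

  spread-even : ∀ r k → spread r (2 ℕ.* k) ≡ r k
  spread-even r zero    = refl
  spread-even r (suc k) = trans (cong (spread r) (2*suc k)) (spread-even (r ∘ suc) k)

  spread-odd : ∀ r k → spread r (suc (2 ℕ.* k)) ≡ + 0
  spread-odd r zero    = refl
  spread-odd r (suc k) = trans (cong (spread r ∘ suc) (2*suc k)) (spread-odd (r ∘ suc) k)

  ∑-spread : ∀ c r N → ∑ (λ j → c j * spread r j) (2 ℕ.* N) ≡ ∑ (λ k → c (2 ℕ.* k) * r k) N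
  ∑-spread c r zero    = refl
  ∑-spread c r (suc N) = begin
    ∑ (λ j → c j * spread r j) (2 ℕ.* suc N)
      ≡⟨ cong (∑ (λ j → c j * spread r j)) (2*suc N) ⟩
    c 0 * r 0 + (c 1 * + 0 + ∑ (λ j → c (suc (suc j)) * spread (r ∘ suc) j) (2 ℕ.* N))
      ≡⟨ cong (λ x → c 0 * r 0 + (c 1 * + 0 + x)) (∑-spread (c ∘ suc ∘ suc) (r ∘ suc) N) ⟩
    c 0 * r 0 + (c 1 * + 0 + ∑ (λ k → c (suc (suc (2 ℕ.* k))) * r (suc k)) N)
      ≡⟨ cong (_+_ (c 0 * r 0)) (lemma (c 1) _) ⟩
    c 0 * r 0 + ∑ (λ k → c (suc (suc (2 ℕ.* k))) * r (suc k)) N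
      ≡⟨ cong (_+_ (c 0 * r 0)) (∑-ext N λ k → cong (λ x → c x * r (suc k)) (2*suc k)) ⟨
    c 0 * r 0 + ∑ (λ k → c (2 ℕ.* suc k) * r (suc k)) N ∎
    where
    lemma : ∀ a x → a * + 0 + x ≡ x
    lemma = solve-∀

  φ : ℕ → ℤ
  φ = spread ratio

  W≡∑ : ∀ n → W n ≡ ∑ (λ k → + (n C (2 ℕ.* k)) * ratio k) (suc (n ℕD./ 2))
  W≡∑ n = cong sumℤ (map-upTo (λ k → + (n C (2 ℕ.* k)) * ratio k) (suc (n ℕD./ 2)))

  n<2*suc[n/2] : ∀ n → n ℕ.< 2 ℕ.* suc (n ℕD./ 2)
  n<2*suc[n/2] n = ℕP.<-≤-trans (subst (ℕ._< (2 ℕ.+ (n ℕD./ 2) ℕ.* 2)) (sym (ℕD.m≡m%n+[m/n]*n n 2))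
                     (ℕP.+-monoˡ-< ((n ℕD./ 2) ℕ.* 2) (ℕD.m%n<n n 2)))
                   (ℕP.≤-reflexive (ℕP.*-comm (suc (n ℕD./ 2)) 2))

  W≡B : ∀ n → W n ≡ B φ n
  W≡B n = begin
    W n                                                            ≡⟨ W≡∑ n ⟩
    ∑ (λ k → + (n C (2 ℕ.* k)) * ratio k) (suc (n ℕD./ 2))         ≡⟨ ∑-spread (λ j → + (n C j)) ratio (suc (n ℕD./ 2)) ⟨
    ∑ (λ j → + (n C j) * φ j) (2 ℕ.* suc (n ℕD./ 2))               ≡⟨ B-∑ φ (n<2*suc[n/2] n) ⟨
    B φ n                                                          ∎

  -- The binomial theorem: shifting the sequence of powers multiplies it by `x`.
  B-geometric : ∀ x n → B (x ^_) n ≡ (+ 1 + x) ^ n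
  B-geometric x zero    = refl
  B-geometric x (suc n) = trans (cong (_+_ (B (x ^_) n)) (B-* x (x ^_) n))
      (trans (lemma (B (x ^_) n) x) (cong (_*_ (+ 1 + x)) (B-geometric x n)))
    where
    lemma : ∀ b x → b + x * b ≡ (+ 1 + x) * b
    lemma = solve-∀

  ^-distribʳ-* : ∀ x y n → (x * y) ^ n ≡ x ^ n * y ^ n
  ^-distribʳ-* x y zero    = refl
  ^-distribʳ-* x y (suc n) = trans (cong (_*_ (x * y)) (^-distribʳ-* x y n)) (lemma x y (x ^ n) (y ^ n))
    where
    lemma : ∀ x y a b → (x * y) * (a * b) ≡ (x * a) * (y * b)
    lemma = solve-∀

  -- Congruences

  module Mod (m : ℤ) where

    infix 4 _≈_ _≈by_
    -- The signed quotient is kept as a witness, so that a congruence becomes a ring identity for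
    -- the solver. As a record type it also lets both sides be inferred.
    record _≈_ (x y : ℤ) : Set where
      constructor _≈by_
      field
        quotient : ℤ
        equation : x ≡ y + quotient * m

    ≡⇒≈ : ∀ {x y} → x ≡ y → x ≈ y
    ≡⇒≈ {x} refl = + 0 ≈by lemma x m
      where
      lemma : ∀ x m → x ≡ x + + 0 * m
      lemma = solve-∀

    ≈-refl : ∀ {x} → x ≈ x
    ≈-refl = ≡⇒≈ refl

    ≈-sym : ∀ {x y} → x ≈ y → y ≈ x
    ≈-sym {y = y} (q ≈by refl) = - q ≈by lemma y q m
      where
      lemma : ∀ y q m → y ≡ (y + q * m) + (- q) * m
      lemma = solve-∀

    ≈-trans : ∀ {x y z} → x ≈ y → y ≈ z → x ≈ z
    ≈-trans {z = z} (q ≈by refl) (r ≈by refl) = r + q ≈by lemma z r q m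
      where
      lemma : ∀ z r q m → (z + r * m) + q * m ≡ z + (r + q) * m
      lemma = solve-∀

    ≈-setoid : Setoid _ _
    ≈-setoid = record
      { Carrier = ℤ ; _≈_ = _≈_
      ; isEquivalence = record { refl = ≈-refl ; sym = ≈-sym ; trans = ≈-trans } }

    +-cong : ∀ {a b x y} → a ≈ b → x ≈ y → a + x ≈ b + y
    +-cong {b = b} {y = y} (q ≈by refl) (r ≈by refl) = q + r ≈by lemma b q y r m
      where
      lemma : ∀ b q y r m → (b + q * m) + (y + r * m) ≡ (b + y) + (q + r) * m
      lemma = solve-∀

    *-cong : ∀ {a b x y} → a ≈ b → x ≈ y → a * x ≈ b * y
    *-cong {b = b} {y = y} (q ≈by refl) (r ≈by refl) = q * y + b * r + q * r * m ≈by lemma b q y r m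
      where
      lemma : ∀ b q y r m → (b + q * m) * (y + r * m) ≡ b * y + (q * y + b * r + q * r * m) * m
      lemma = solve-∀

    +-congˡ : ∀ a {x y} → x ≈ y → a + x ≈ a + y
    +-congˡ a = +-cong (≈-refl {a})

    +-congʳ : ∀ a {x y} → x ≈ y → x + a ≈ y + a
    +-congʳ a h = +-cong h (≈-refl {a})

    *-congˡ : ∀ a {x y} → x ≈ y → a * x ≈ a * y
    *-congˡ a = *-cong (≈-refl {a})

    *-congʳ : ∀ a {x y} → x ≈ y → x * a ≈ y * a
    *-congʳ a h = *-cong h (≈-refl {a})

    ^-cong : ∀ {x y} n → x ≈ y → x ^ n ≈ y ^ n
    ^-cong zero    h = ≈-refl
    ^-cong (suc n) h = *-cong h (^-cong n h)

    m*≈0 : ∀ x → m * x ≈ + 0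
    m*≈0 x = x ≈by lemma m x
      where
      lemma : ∀ m x → m * x ≡ + 0 + x * m
      lemma = solve-∀

    -≈0⇒≈ : ∀ {x y} → x - y ≈ + 0 → x ≈ y
    -≈0⇒≈ {x} {y} (q ≈by e) = q ≈by trans (lemma₁ x y) (trans (cong (_+_ y) e) (lemma₂ y (q * m)))
      where
      lemma₁ : ∀ x y → x ≡ y + (x - y)
      lemma₁ = solve-∀
      lemma₂ : ∀ x y → x + (+ 0 + y) ≡ x + y
      lemma₂ = solve-∀

    ≈⇒-≈0 : ∀ {x y} → x ≈ y → x - y ≈ + 0
    ≈⇒-≈0 {x} {y} h = ≈-trans (+-congʳ (- y) h) (≡⇒≈ (ℤP.+-inverseʳ y))

    ≈0⇒∣ : ∀ {x} → x ≈ + 0 → m Signed.∣ x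
    ≈0⇒∣ (q ≈by e) = Signed.divides q (trans e (ℤP.+-identityˡ _))

    ∣⇒≈0 : ∀ {x} → m Signed.∣ x → x ≈ + 0
    ∣⇒≈0 (Signed.divides q e) = q ≈by trans e (sym (ℤP.+-identityˡ _))

    ≈⇒≡[mod] : ∀ {x y} → x ≈ y → x ≡ y [mod m ]
    ≈⇒≡[mod] h = Signed.∣⇒∣ᵤ (≈0⇒∣ (≈⇒-≈0 h))

    ≡[mod]⇒≈ : ∀ {x y} → x ≡ y [mod m ] → x ≈ y
    ≡[mod]⇒≈ {x} {y} h = -≈0⇒≈ (∣⇒≈0 (Signed.∣ᵤ⇒∣ {m} {x - y} h))

    ∑-cong : ∀ {f g} n → (∀ k → k ℕ.< n → f k ≈ g k) → ∑ f n ≈ ∑ g n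
    ∑-cong zero    h = ≈-refl
    ∑-cong (suc n) h = +-cong (h 0 (s≤s z≤n)) (∑-cong n λ k k<n → h (suc k) (s≤s k<n))

    B-≈0 : ∀ {f} n → (∀ j → f j ≈ + 0) → B f n ≈ + 0
    B-≈0 zero    h = h 0
    B-≈0 (suc n) h = +-cong (B-≈0 n h) (B-≈0 n (h ∘ suc))

    B-≈head : ∀ {f} n → (∀ j → f (suc j) ≈ + 0) → B f n ≈ f 0
    B-≈head         zero    h = ≈-refl
    B-≈head {f}     (suc n) h = ≈-trans (+-cong (B-≈head n h) (B-≈0 n h)) (≡⇒≈ (ℤP.+-identityʳ (f 0)))

  -- The recurrence of the ratios

  absorption : ∀ n k → suc k ℕ.* (suc n C suc k) ≡ suc n ℕ.* (n C k)
  absorption zero    zero    = refl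
  absorption zero    (suc k) = ℕP.*-zeroʳ (suc (suc k))
  absorption (suc n) zero    = trans (ℕP.*-identityˡ _) (trans (nC1≡n (suc (suc n))) (sym (ℕP.*-identityʳ _)))
  absorption (suc n) (suc k) = begin
    suc (suc k) ℕ.* (suc (suc n) C suc (suc k))
      ≡⟨ cong (suc (suc k) ℕ.*_) (nCk+nC[k+1]≡[n+1]C[k+1] (suc n) (suc k)) ⟨
    suc (suc k) ℕ.* (c₁ ℕ.+ c₂)
      ≡⟨ lemma₁ k c₁ c₂ ⟩
    suc k ℕ.* c₁ ℕ.+ (c₁ ℕ.+ suc (suc k) ℕ.* c₂)
      ≡⟨ cong₂ (λ x y → x ℕ.+ (c₁ ℕ.+ y)) (absorption n k) (absorption n (suc k)) ⟩
    suc n ℕ.* (n C k) ℕ.+ (c₁ ℕ.+ suc n ℕ.* (n C suc k))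
      ≡⟨ lemma₂ n (n C k) (n C suc k) c₁ ⟩
    suc n ℕ.* (n C k ℕ.+ n C suc k) ℕ.+ c₁
      ≡⟨ cong (λ x → suc n ℕ.* x ℕ.+ c₁) (nCk+nC[k+1]≡[n+1]C[k+1] n k) ⟩
    suc n ℕ.* c₁ ℕ.+ c₁
      ≡⟨ ℕP.+-comm (suc n ℕ.* c₁) c₁ ⟩
    suc (suc n) ℕ.* c₁ ∎
    where
    c₁ = suc n C suc k
    c₂ = suc n C suc (suc k)
    lemma₁ : ∀ k a b → suc (suc k) ℕ.* (a ℕ.+ b) ≡ suc k ℕ.* a ℕ.+ (a ℕ.+ suc (suc k) ℕ.* b)
    lemma₁ = ℕR.solve-∀
    lemma₂ : ∀ n a b c → suc n ℕ.* a ℕ.+ (c ℕ.+ suc n ℕ.* b) ≡ suc n ℕ.* (a ℕ.+ b) ℕ.+ c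
    lemma₂ = ℕR.solve-∀

  -- Adding (k+1) C(n,k) to both sides gives `absorption` after Pascal's rule. The signed difference
  -- avoids a case distinction on k ≤ n.
  absorption-ℤ : ∀ n k → + suc k * + (n C suc k) ≡ (+ n - + k) * + (n C k)
  absorption-ℤ n k = ∙-cancelˡ ((+ suc k) * + (n C k)) _ _ (begin
    + suc k * + (n C k) + + suc k * + (n C suc k)
      ≡⟨ ℤP.*-distribˡ-+ (+ suc k) (+ (n C k)) _ ⟨
    + suc k * + (n C k ℕ.+ n C suc k)
      ≡⟨ cong (λ x → + suc k * + x) (nCk+nC[k+1]≡[n+1]C[k+1] n k) ⟩
    + suc k * + (suc n C suc k)
      ≡⟨ ℤP.pos-* (suc k) _ ⟨
    + (suc k ℕ.* (suc n C suc k))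
      ≡⟨ cong +_ (absorption n k) ⟩
    + (suc n ℕ.* (n C k))
      ≡⟨ ℤP.pos-* (suc n) _ ⟩
    + suc n * + (n C k)
      ≡⟨ lemma (+ n) (+ k) (+ (n C k)) ⟩
    + suc k * + (n C k) + (+ n - + k) * + (n C k) ∎)
    where
    lemma : ∀ n k c → (+ 1 + n) * c ≡ (+ 1 + k) * c + (n - k) * c
    lemma = solve-∀

  [2k+1]Ck≡[2k+1]C[k+1] : ∀ k → suc (2 ℕ.* k) C k ≡ suc (2 ℕ.* k) C suc k
  [2k+1]Ck≡[2k+1]C[k+1] k = trans (nCk≡nC[n∸k] k≤) (cong (suc (2 ℕ.* k) C_) eq)
    where
    split : suc (2 ℕ.* k) ≡ k ℕ.+ suc k
    split = lemma k
      where
      lemma : ∀ k → suc (2 ℕ.* k) ≡ k ℕ.+ suc k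
      lemma = ℕR.solve-∀
    k≤ : k ℕ.≤ suc (2 ℕ.* k)
    k≤ = subst (k ℕ.≤_) (sym split) (ℕP.m≤m+n k (suc k))
    eq : suc (2 ℕ.* k) ℕ.∸ k ≡ suc k
    eq = trans (cong (ℕ._∸ k) split) (ℕP.m+n∸m≡n k (suc k))

  central : ℕ → ℕ
  central k = (2 ℕ.* k) C k

  central-suc : ∀ k → central (suc k) ≡ 2 ℕ.* (suc (2 ℕ.* k) C k)
  central-suc k = begin
    (2 ℕ.* suc k) C suc k            ≡⟨ cong (_C suc k) (2*suc k) ⟩
    suc (suc (2 ℕ.* k)) C suc k      ≡⟨ nCk+nC[k+1]≡[n+1]C[k+1] (suc (2 ℕ.* k)) k ⟨
    c ℕ.+ suc (2 ℕ.* k) C suc k      ≡⟨ cong (c ℕ.+_) ([2k+1]Ck≡[2k+1]C[k+1] k) ⟨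
    c ℕ.+ c                          ≡⟨ cong (c ℕ.+_) (ℕP.+-identityʳ c) ⟨
    2 ℕ.* c                          ∎
    where c = suc (2 ℕ.* k) C k

  central-rec : ∀ k → suc k ℕ.* central (suc k) ≡ suc (2 ℕ.* k) ℕ.* (2 ℕ.* central k)
  central-rec k = begin
    suc k ℕ.* central (suc k)                    ≡⟨ cong (suc k ℕ.*_) (trans (central-suc k) (cong (2 ℕ.*_) ([2k+1]Ck≡[2k+1]C[k+1] k))) ⟩
    suc k ℕ.* (2 ℕ.* (suc (2 ℕ.* k) C suc k))    ≡⟨ lemma (suc k) 2 (suc (2 ℕ.* k) C suc k) ⟩
    2 ℕ.* (suc k ℕ.* (suc (2 ℕ.* k) C suc k))    ≡⟨ cong (2 ℕ.*_) (absorption (2 ℕ.* k) k) ⟩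
    2 ℕ.* (suc (2 ℕ.* k) ℕ.* central k)          ≡⟨ lemma 2 (suc (2 ℕ.* k)) (central k) ⟩
    suc (2 ℕ.* k) ℕ.* (2 ℕ.* central k)          ∎
    where
    lemma : ∀ a b c → a ℕ.* (b ℕ.* c) ≡ b ℕ.* (a ℕ.* c)
    lemma = ℕR.solve-∀

  -- By `central-rec`, 2k+1 divides (k+1) `central (suc k)`, and it is coprime to k+1 because 2(k+1)
  -- - (2k+1) = 1. Hence the division in `ratio` is exact.
  2k+1∣central : ∀ k → suc (2 ℕ.* k) ℕDiv.∣ central (suc k)
  2k+1∣central k = coprime-divisor coprime (ℕDiv.divides (2 ℕ.* central k)
      (trans (central-rec k) (ℕP.*-comm (suc (2 ℕ.* k)) _)))
    where
    coprime : Coprime (suc (2 ℕ.* k)) (suc k)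
    coprime {d} (d∣2k+1 , d∣k+1) = ℕDiv.∣1⇒≡1 (ℕDiv.∣m+n∣m⇒∣n
      (subst (d ℕDiv.∣_) (lemma k) (ℕDiv.∣n⇒∣m*n 2 d∣k+1)) d∣2k+1)
      where
      lemma : ∀ k → 2 ℕ.* suc k ≡ suc (2 ℕ.* k) ℕ.+ 1
      lemma = ℕR.solve-∀

  ratio-central : ∀ k → + suc (2 ℕ.* k) * ratio (suc k) ≡ + central (suc k)
  ratio-central k = begin
    + suc (2 ℕ.* k) * ratio (suc k)                               ≡⟨ ℤP.pos-* (suc (2 ℕ.* k)) _ ⟨
    + (suc (2 ℕ.* k) ℕ.* (central (suc k) ℕD./ suc (2 ℕ.* k)))    ≡⟨ cong +_ (ℕD.m*[n/m]≡n (2k+1∣central k)) ⟩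
    + central (suc k)                                             ∎

  +2k+1 : ∀ k → + suc (2 ℕ.* k) ≡ + 1 + + 2 * + k
  +2k+1 k = cong (_+_ (+ 1)) (ℤP.pos-* 2 k)

  [2k-1]*ratio : ∀ k → (+ 2 * + k - + 1) * ratio k ≡ + central k
  [2k-1]*ratio zero    = refl
  [2k-1]*ratio (suc k) = trans (cong (_* ratio (suc k)) (trans (lemma (+ k)) (sym (+2k+1 k)))) (ratio-central k)
    where
    lemma : ∀ k → + 2 * (+ 1 + k) - + 1 ≡ + 1 + + 2 * k
    lemma = solve-∀

  -- After multiplication by 2k+1 the left side is (k+1) `central (suc k)`; `central-rec` yields the
  -- same factor on the right, with `central k` equal to (2k-1) `ratio k`.
  ratio-rec : ∀ k → + suc k * ratio (suc k) ≡ + 2 * (+ 2 * + k - + 1) * ratio k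
  ratio-rec k = ℤP.*-cancelˡ-≡ (+ suc (2 ℕ.* k)) _ _ (begin
    + suc (2 ℕ.* k) * (+ suc k * ratio (suc k))
      ≡⟨ lemma₁ (+ suc (2 ℕ.* k)) (+ suc k) _ ⟩
    + suc k * (+ suc (2 ℕ.* k) * ratio (suc k))
      ≡⟨ cong (_*_ (+ suc k)) (ratio-central k) ⟩
    + suc k * + central (suc k)
      ≡⟨ ℤP.pos-* (suc k) _ ⟨
    + (suc k ℕ.* central (suc k))
      ≡⟨ cong +_ (central-rec k) ⟩
    + (suc (2 ℕ.* k) ℕ.* (2 ℕ.* central k))
      ≡⟨ trans (ℤP.pos-* (suc (2 ℕ.* k)) _) (cong (_*_ (+ suc (2 ℕ.* k))) (ℤP.pos-* 2 (central k))) ⟩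
    + suc (2 ℕ.* k) * (+ 2 * + central k)
      ≡⟨ cong (λ x → + suc (2 ℕ.* k) * (+ 2 * x)) ([2k-1]*ratio k) ⟨
    + suc (2 ℕ.* k) * (+ 2 * ((+ 2 * + k - + 1) * ratio k))
      ≡⟨ cong (_*_ (+ suc (2 ℕ.* k))) (ℤP.*-assoc (+ 2) (+ 2 * + k - + 1) (ratio k)) ⟨
    + suc (2 ℕ.* k) * (+ 2 * (+ 2 * + k - + 1) * ratio k) ∎)
    where
    lemma₁ : ∀ a b c → a * (b * c) ≡ b * (a * c)
    lemma₁ = solve-∀

  -- The recurrence of W and the closed form of S

  data Parity : ℕ → Set where
    even : ∀ k → Parity (2 ℕ.* k)
    odd  : ∀ k → Parity (suc (2 ℕ.* k))

  parity : ∀ n → Parity n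
  parity zero = even 0
  parity (suc n) with parity n
  ... | even k = odd k
  ... | odd k  = subst Parity (2*suc k) (even (suc k))

  φ-rec : ∀ j → (+ 2 + + j) * φ (2 ℕ.+ j) ≡ + 4 * (+ j - + 1) * φ j
  φ-rec j with parity j
  ... | even k = begin
    (+ 2 + + (2 ℕ.* k)) * φ (2 ℕ.+ 2 ℕ.* k)     ≡⟨ cong₂ (λ x y → (+ 2 + x) * y) (ℤP.pos-* 2 k) (spread-even (ratio ∘ suc) k) ⟩
    (+ 2 + + 2 * + k) * ratio (suc k)            ≡⟨ lemma₁ (+ k) (ratio (suc k)) ⟩
    + 2 * (+ suc k * ratio (suc k))              ≡⟨ cong (_*_ (+ 2)) (ratio-rec k) ⟩
    + 2 * (+ 2 * (+ 2 * + k - + 1) * ratio k)    ≡⟨ lemma₂ (+ k) (ratio k) ⟩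
    + 4 * (+ 2 * + k - + 1) * ratio k            ≡⟨ cong₂ (λ x y → + 4 * (x - + 1) * y) (ℤP.pos-* 2 k) (spread-even ratio k) ⟨
    + 4 * (+ (2 ℕ.* k) - + 1) * φ (2 ℕ.* k)      ∎
    where
    lemma₁ : ∀ k r → (+ 2 + + 2 * k) * r ≡ + 2 * ((+ 1 + k) * r)
    lemma₁ = solve-∀
    lemma₂ : ∀ k r → + 2 * (+ 2 * (+ 2 * k - + 1) * r) ≡ + 4 * (+ 2 * k - + 1) * r
    lemma₂ = solve-∀
  ... | odd k = begin
    x * φ (suc (2 ℕ.+ 2 ℕ.* k))   ≡⟨ cong (_*_ x) (spread-odd (ratio ∘ suc) k) ⟩
    x * + 0                       ≡⟨ ℤP.*-zeroʳ x ⟩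
    + 0                           ≡⟨ ℤP.*-zeroʳ y ⟨
    y * + 0                       ≡⟨ cong (_*_ y) (spread-odd ratio k) ⟨
    y * φ (suc (2 ℕ.* k))         ∎
    where
    x = + 2 + + suc (2 ℕ.* k)
    y = + 4 * (+ suc (2 ℕ.* k) - + 1)

  G : ℕ → ℤ
  G = B (λ j → + j * φ j)

  G-suc : ∀ n → G (suc n) ≡ + suc n * (W (suc n) - W n)
  G-suc n = begin
    G (suc n)                                 ≡⟨ B-j* φ n ⟩
    + suc n * B (φ ∘ suc) n                   ≡⟨ cong (_*_ (+ suc n)) (lemma (B φ n) _) ⟩
    + suc n * (B φ (suc n) - B φ n)           ≡⟨ cong₂ (λ x y → + suc n * (x - y)) (W≡B (suc n)) (W≡B n) ⟨
    + suc n * (W (suc n) - W n)               ∎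
    where
    lemma : ∀ x y → y ≡ (x + y) - x
    lemma = solve-∀

  -- Shifting a sequence takes the forward difference of its transform; here this happens twice.
  B-Δ² : ∀ g n → B (λ j → g (2 ℕ.+ j)) n ≡ B g (2 ℕ.+ n) - + 2 * B g (suc n) + B g n
  B-Δ² g n = lemma (B g n) (B (g ∘ suc) n) _
    where
    lemma : ∀ x y z → z ≡ ((x + y) + (y + z)) - + 2 * (x + y) + x
    lemma = solve-∀

  -- The left side is the transform of (j+2) φ(j+2), which `φ-rec` rewrites as 4 j φ(j) - 4 φ(j).
  G-rec : ∀ n → G (2 ℕ.+ n) - + 2 * G (suc n) + G n ≡ + 4 * G n - + 4 * W n
  G-rec n = begin
    G (2 ℕ.+ n) - + 2 * G (suc n) + G n
      ≡⟨ B-Δ² (λ j → + j * φ j) n ⟨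
    B (λ j → + (2 ℕ.+ j) * φ (2 ℕ.+ j)) n
      ≡⟨ B-ext n (λ j → trans (φ-rec j) (lemma₁ (+ j) (φ j))) ⟩
    B (λ j → + 4 * (+ j * φ j) + (- + 4) * φ j) n
      ≡⟨ B-+ (λ j → + 4 * (+ j * φ j)) (λ j → (- + 4) * φ j) n ⟩
    B (λ j → + 4 * (+ j * φ j)) n + B (λ j → (- + 4) * φ j) n
      ≡⟨ cong₂ _+_ (B-* (+ 4) (λ j → + j * φ j) n) (B-* (- + 4) φ n) ⟩
    + 4 * G n + (- + 4) * B φ n
      ≡⟨ cong (λ x → + 4 * G n + (- + 4) * x) (W≡B n) ⟨
    + 4 * G n + (- + 4) * W n
      ≡⟨ lemma₂ (G n) (W n) ⟩
    + 4 * G n - + 4 * W n ∎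
    where
    lemma₁ : ∀ j x → + 4 * (j - + 1) * x ≡ + 4 * (j * x) + (- + 4) * x
    lemma₁ = solve-∀
    lemma₂ : ∀ g w → + 4 * g + (- + 4) * w ≡ + 4 * g - + 4 * w
    lemma₂ = solve-∀

  X : ℕ → ℤ
  X n = W (suc n) - + 3 * W n

  -- Z (n + 1) = (n + 1) X n; going through G avoids the predecessor, so that Z 0 = 0 fits the recurrence.
  Z : ℕ → ℤ
  Z n = + 3 * G n - + 2 * + n * W n

  Z-suc : ∀ n → Z (suc n) ≡ + suc n * X n
  Z-suc n = trans (cong (λ g → + 3 * g - + 2 * + suc n * W (suc n)) (G-suc n)) (lemma (+ suc n) (W n) (W (suc n)))
    where
    lemma : ∀ n w w′ → + 3 * (n * (w′ - w)) - + 2 * n * w′ ≡ n * (w′ - + 3 * w)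
    lemma = solve-∀

  -- This computation dictates the shape of `Z`: `G-rec` leaves 3 G(n), and the terms in W(n) whose
  -- coefficient grows with n add up to -2 n W(n).
  Z-rec : ∀ n → Z (2 ℕ.+ n) ≡ Z n - + 2 * W (suc n) - + 6 * W n
  Z-rec n = begin
    Z (2 ℕ.+ n)
      ≡⟨ Z-suc (suc n) ⟩
    + (2 ℕ.+ n) * X (suc n)
      ≡⟨ lemma₁ (+ n) (W (suc n)) (W (2 ℕ.+ n)) ⟩
    + (2 ℕ.+ n) * (W (2 ℕ.+ n) - W (suc n)) - + 2 * + (2 ℕ.+ n) * W (suc n)
      ≡⟨ cong (_- + 2 * + (2 ℕ.+ n) * W (suc n)) (G-suc (suc n)) ⟨
    G (2 ℕ.+ n) - + 2 * + (2 ℕ.+ n) * W (suc n)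
      ≡⟨ cong (_- + 2 * + (2 ℕ.+ n) * W (suc n)) (lemma₂ (G (2 ℕ.+ n)) (G (suc n)) (G n)) ⟩
    (G (2 ℕ.+ n) - + 2 * G (suc n) + G n) + + 2 * G (suc n) - G n - + 2 * + (2 ℕ.+ n) * W (suc n)
      ≡⟨ cong₂ (λ x y → x + + 2 * y - G n - + 2 * + (2 ℕ.+ n) * W (suc n)) (G-rec n) (G-suc n) ⟩
    (+ 4 * G n - + 4 * W n) + + 2 * (+ suc n * (W (suc n) - W n)) - G n - + 2 * + (2 ℕ.+ n) * W (suc n)
      ≡⟨ lemma₃ (+ n) (W n) (W (suc n)) (G n) ⟩
    Z n - + 2 * W (suc n) - + 6 * W n ∎
    where
    lemma₁ : ∀ n w w′ → (+ 2 + n) * (w′ - + 3 * w) ≡ (+ 2 + n) * (w′ - w) - + 2 * (+ 2 + n) * w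
    lemma₁ = solve-∀
    lemma₂ : ∀ a b c → a ≡ (a - + 2 * b + c) + + 2 * b - c
    lemma₂ = solve-∀
    lemma₃ : ∀ n w w′ g → (+ 4 * g - + 4 * w) + + 2 * ((+ 1 + n) * (w′ - w)) - g - + 2 * (+ 2 + n) * w′
                        ≡ (+ 3 * g - + 2 * n * w) - + 2 * w′ - + 6 * w
    lemma₃ = solve-∀

  S-suc : ∀ n → S (suc n) ≡ S n + (+ 8 * + n + + 9) * (W n * W n)
  S-suc n = begin
    S (suc n)      ≡⟨ S≡∑ (suc n) ⟩
    ∑ s (suc n)    ≡⟨ ∑-snoc s n ⟩
    ∑ s n + s n    ≡⟨ cong₂ (λ x y → x + (y + + 9) * (W n * W n)) (sym (S≡∑ n)) (ℤP.pos-* 8 n) ⟩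
    S n + (+ 8 * + n + + 9) * (W n * W n) ∎
    where
    s : ℕ → ℤ
    s k = + (8 ℕ.* k ℕ.+ 9) * (W k * W k)
    S≡∑ : ∀ n → S n ≡ ∑ s n
    S≡∑ n = cong sumℤ (map-upTo s n)

  -- In the induction step Z(n+1) (Z(n+2) - Z(n)) is -2(n+1) times (W(n+1) - 3 W(n)) (W(n+1) + 3
  -- W(n)), a difference of squares. Its -9 W(n)² cancels the old square term, and 18(n+2) - 2(n+1)
  -- = 2 (8(n+1) + 9) is the weight of the new summand.
  2S-closed : ∀ n → + 2 * S (suc n) ≡ + 18 * + suc n * (W n * W n) + Z n * Z (suc n)
  2S-closed zero    = refl
  2S-closed (suc n) = begin
    + 2 * S (2 ℕ.+ n)
      ≡⟨ cong (_*_ (+ 2)) (S-suc (suc n)) ⟩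
    + 2 * (S (suc n) + (+ 8 * + suc n + + 9) * (w′ * w′))
      ≡⟨ ℤP.*-distribˡ-+ (+ 2) (S (suc n)) _ ⟩
    + 2 * S (suc n) + + 2 * ((+ 8 * + suc n + + 9) * (w′ * w′))
      ≡⟨ cong (_+ + 2 * ((+ 8 * + suc n + + 9) * (w′ * w′))) (2S-closed n) ⟩
    (+ 18 * + suc n * (w * w) + Z n * Z (suc n)) + + 2 * ((+ 8 * + suc n + + 9) * (w′ * w′))
      ≡⟨ cong (λ z → (+ 18 * + suc n * (w * w) + Z n * z) + + 2 * ((+ 8 * + suc n + + 9) * (w′ * w′))) (Z-suc n) ⟩
    (+ 18 * + suc n * (w * w) + Z n * (+ suc n * X n)) + + 2 * ((+ 8 * + suc n + + 9) * (w′ * w′))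
      ≡⟨ lemma (+ n) w w′ (Z n) ⟩
    + 18 * + (2 ℕ.+ n) * (w′ * w′) + (+ suc n * X n) * (Z n - + 2 * w′ - + 6 * w)
      ≡⟨ cong₂ (λ y z → + 18 * + (2 ℕ.+ n) * (w′ * w′) + y * z) (Z-suc n) (Z-rec n) ⟨
    + 18 * + (2 ℕ.+ n) * (w′ * w′) + Z (suc n) * Z (2 ℕ.+ n) ∎
    where
    w = W n
    w′ = W (suc n)
    lemma : ∀ n w w′ z →
      (+ 18 * (+ 1 + n) * (w * w) + z * ((+ 1 + n) * (w′ - + 3 * w))) + + 2 * ((+ 8 * (+ 1 + n) + + 9) * (w′ * w′))
      ≡ + 18 * (+ 2 + n) * (w′ * w′) + ((+ 1 + n) * (w′ - + 3 * w)) * (z - + 2 * w′ - + 6 * w)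
    lemma = solve-∀

  -- Parity, and the congruence modulo 2n

  module Mod2 = Mod (+ 2)

  -- The odd multiple (2k+1) `ratio (suc k)` is the central binomial coefficient 2 C(2k+1,k), which
  -- is even.
  ratio-even : ∀ k → ratio (suc k) Mod2.≈ + 0
  ratio-even k = -≈0⇒≈ ((+ c - + k * r) ≈by (begin
    r - + 0                                         ≡⟨ lemma₁ (+ k) r ⟩
    (+ 1 + + 2 * + k) * r - + 2 * + k * r           ≡⟨ cong (λ x → x * r - + 2 * + k * r) (+2k+1 k) ⟨
    + suc (2 ℕ.* k) * r - + 2 * + k * r             ≡⟨ cong (_- + 2 * + k * r) (ratio-central k) ⟩
    + central (suc k) - + 2 * + k * r               ≡⟨ cong (λ x → + x - + 2 * + k * r) (central-suc k) ⟩
    + (2 ℕ.* c) - + 2 * + k * r                     ≡⟨ cong (_- + 2 * + k * r) (ℤP.pos-* 2 c) ⟩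
    + 2 * + c - + 2 * + k * r                       ≡⟨ lemma₂ (+ k) r (+ c) ⟩
    + 0 + (+ c - + k * r) * + 2                     ∎))
    where
    open Mod2
    c = suc (2 ℕ.* k) C k
    r = ratio (suc k)
    lemma₁ : ∀ k r → r - + 0 ≡ (+ 1 + + 2 * k) * r - + 2 * k * r
    lemma₁ = solve-∀
    lemma₂ : ∀ k r c → + 2 * c - + 2 * k * r ≡ + 0 + (c - k * r) * + 2
    lemma₂ = solve-∀

  φ-even : ∀ j → φ (suc j) Mod2.≈ + 0
  φ-even j with parity j
  ... | even k = Mod2.≡⇒≈ (spread-odd ratio k)
  ... | odd k  = Mod2.≈-trans (Mod2.≡⇒≈ (spread-even (ratio ∘ suc) k)) (ratio-even k)

  W-odd : ∀ n → W n Mod2.≈ - + 1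
  W-odd n = Mod2.≈-trans (Mod2.≡⇒≈ (W≡B n)) (Mod2.B-≈head {φ} n φ-even)

  G-even : ∀ n → G n Mod2.≈ + 0
  G-even n = Mod2.B-≈0 n λ where
    zero    → Mod2.≈-refl
    (suc j) → Mod2.≈-trans (Mod2.*-congˡ (+ suc j) (φ-even j)) (Mod2.≡⇒≈ (ℤP.*-zeroʳ (+ suc j)))

  -- The equation for 2q evaluates q modulo an odd prime; the oddness of q, inherited from 9 W(n)²,
  -- gives the congruence modulo 2n.
  S-quotient : ∀ n → ∃[ q ] (S (suc n) ≡ + suc n * q × + 2 * q ≡ + 18 * (W n * W n) + X n * Z n × q Mod2.≈ + 1)
  S-quotient n = go (W-odd n) (W-odd (suc n)) (G-even n)
    where
    go : W n Mod2.≈ - + 1 → W (suc n) Mod2.≈ - + 1 → G n Mod2.≈ + 0 →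
         ∃[ q ] (S (suc n) ≡ + suc n * q × + 2 * q ≡ + 18 * (W n * W n) + X n * Z n × q Mod2.≈ + 1)
    go (a Mod2.≈by wa) (b Mod2.≈by wb) (g Mod2.≈by gg) = q , S≡ , 2q≡ , (y Mod2.≈by q≡)
      where
      -- `x` and `z` are the halves of `X n` and `Z n`, computed from W(n) = -1 + 2a, W(n+1) = -1 +
      -- 2b and G(n) = 2g.
      x = b - + 3 * a + + 1
      z = + 3 * g - + n * W n
      q = + 9 * (W n * W n) + + 2 * (x * z)
      y = + 4 - + 18 * a + + 18 * a * a + x * z
      X≡ : X n ≡ + 2 * x
      X≡ = trans (cong₂ (λ u v → v - + 3 * u) wa wb) (lemma a b)
        where
        lemma : ∀ a b → (- + 1 + b * + 2) - + 3 * (- + 1 + a * + 2) ≡ + 2 * (b - + 3 * a + + 1)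
        lemma = solve-∀
      Z≡ : Z n ≡ + 2 * z
      Z≡ = trans (cong (λ u → + 3 * u - + 2 * + n * W n) gg) (lemma g (+ n) (W n))
        where
        lemma : ∀ g n w → + 3 * (+ 0 + g * + 2) - + 2 * n * w ≡ + 2 * (+ 3 * g - n * w)
        lemma = solve-∀
      2q≡ : + 2 * q ≡ + 18 * (W n * W n) + X n * Z n
      2q≡ = trans (lemma (W n * W n) x z) (sym (cong₂ (λ u v → + 18 * (W n * W n) + u * v) X≡ Z≡))
        where
        lemma : ∀ w x z → + 2 * (+ 9 * w + + 2 * (x * z)) ≡ + 18 * w + (+ 2 * x) * (+ 2 * z)
        lemma = solve-∀
      q≡ : q ≡ + 1 + y * + 2
      q≡ = trans (cong (λ w → + 9 * (w * w) + + 2 * (x * z)) wa) (lemma a x z)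
        where
        lemma : ∀ a x z → + 9 * ((- + 1 + a * + 2) * (- + 1 + a * + 2)) + + 2 * (x * z)
                        ≡ + 1 + (+ 4 - + 18 * a + + 18 * a * a + x * z) * + 2
        lemma = solve-∀
      S≡ : S (suc n) ≡ + suc n * q
      S≡ = ℤP.*-cancelˡ-≡ (+ 2) _ _ (begin
        + 2 * S (suc n)
          ≡⟨ 2S-closed n ⟩
        + 18 * + suc n * (W n * W n) + Z n * Z (suc n)
          ≡⟨ cong (λ y → + 18 * + suc n * (W n * W n) + Z n * y) (Z-suc n) ⟩
        + 18 * + suc n * (W n * W n) + Z n * (+ suc n * X n)
          ≡⟨ lemma₁ (+ suc n) (W n * W n) (X n) (Z n) ⟩
        + suc n * (+ 18 * (W n * W n) + X n * Z n)
          ≡⟨ cong (_*_ (+ suc n)) 2q≡ ⟨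
        + suc n * (+ 2 * q)
          ≡⟨ lemma₂ (+ suc n) q ⟩
        + 2 * (+ suc n * q) ∎)
        where
        lemma₁ : ∀ n w x z → + 18 * n * w + z * (n * x) ≡ n * (+ 18 * w + x * z)
        lemma₁ = solve-∀
        lemma₂ : ∀ n q → n * (+ 2 * q) ≡ + 2 * (n * q)
        lemma₂ = solve-∀

  S≡n[mod-2n] : ∀ n → S (suc n) ≡ + (suc n) [mod + (2 ℕ.* suc n) ]
  S≡n[mod-2n] n = go (S-quotient n)
    where
    go : ∃[ q ] (S (suc n) ≡ + suc n * q × + 2 * q ≡ + 18 * (W n * W n) + X n * Z n × q Mod2.≈ + 1) →
         S (suc n) ≡ + (suc n) [mod + (2 ℕ.* suc n) ]
    go (q , S≡ , _ , (y Mod2.≈by q≡)) = Mod.≈⇒≡[mod] (+ (2 ℕ.* suc n)) (y Mod.≈by (begin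
      S (suc n)                          ≡⟨ S≡ ⟩
      + suc n * q                        ≡⟨ cong (_*_ (+ suc n)) q≡ ⟩
      + suc n * (+ 1 + y * + 2)          ≡⟨ lemma (+ suc n) y ⟩
      + suc n + y * (+ 2 * + suc n)      ≡⟨ cong (λ x → + suc n + y * x) (ℤP.pos-* 2 (suc n)) ⟨
      + suc n + y * + (2 ℕ.* suc n)      ∎))
      where
      lemma : ∀ n y → n * (+ 1 + y * + 2) ≡ n + y * (+ 2 * n)
      lemma = solve-∀

-- Lagrange's theorem and Euler's criterion

-- Polynomial functions only: degree is what drops when x - r is divided out, for every r.
data Degree≤ : ℕ → (ℤ → ℤ) → Set where
  constant : ∀ {g} c → (∀ x → g x ≡ c) → Degree≤ 0 g
  factor   : ∀ {d g} → (∀ r → ∃[ q ] (Degree≤ d q × (∀ x → g x ≡ g r + (x - r) * q x))) → Degree≤ (suc d) g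

Degree≤-suc : ∀ {d g} → Degree≤ d g → Degree≤ (suc d) g
Degree≤-suc {g = g} (constant c g≡c) = factor λ r →
    (λ _ → + 0) , constant (+ 0) (λ _ → refl) ,
    λ x → trans (g≡c x) (trans (sym (g≡c r)) (lemma (g r) (x - r)))
  where
  lemma : ∀ a b → a ≡ a + b * + 0
  lemma = solve-∀
Degree≤-suc (factor h) = factor λ r → let q , dq , e = h r in q , Degree≤-suc dq , e

Degree≤-+ : ∀ {d g h} → Degree≤ d g → Degree≤ d h → Degree≤ d (λ x → g x + h x)
Degree≤-+ (constant c g≡) (constant c′ h≡) = constant (c + c′) λ x → cong₂ _+_ (g≡ x) (h≡ x)
Degree≤-+ {g = g} {h} (factor dg) (factor dh) = factor λ r →
  let q , dq , e = dg r ; q′ , dq′ , e′ = dh r in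
  (λ x → q x + q′ x) , Degree≤-+ dq dq′ ,
  λ x → trans (cong₂ _+_ (e x) (e′ x)) (lemma (g r) (h r) (x - r) (q x) (q′ x))
  where
  lemma : ∀ a b s u v → (a + s * u) + (b + s * v) ≡ (a + b) + s * (u + v)
  lemma = solve-∀

Degree≤-scale : ∀ {d g} a → Degree≤ d g → Degree≤ d (λ x → a * g x)
Degree≤-scale a (constant c g≡) = constant (a * c) λ x → cong (_*_ a) (g≡ x)
Degree≤-scale {g = g} a (factor dg) = factor λ r →
  let q , dq , e = dg r in
  (λ x → a * q x) , Degree≤-scale a dq ,
  λ x → trans (cong (_*_ a) (e x)) (lemma a (g r) (x - r) (q x))
  where
  lemma : ∀ a b s u → a * (b + s * u) ≡ a * b + s * (a * u)
  lemma = solve-∀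

-- The new quotient comes from x g(x) - r g(r) = (x-r) g(x) + r (g(x) - g(r)).
Degree≤-x* : ∀ {d g} → Degree≤ d g → Degree≤ (suc d) (λ x → x * g x)
Degree≤-x* {g = g} dg@(constant c g≡) = factor λ r →
  (λ _ → c) , constant c (λ _ → refl) ,
  λ x → trans (cong (_*_ x) (g≡ x)) (trans (lemma x r c) (cong (λ y → r * y + (x - r) * c) (sym (g≡ r))))
  where
  lemma : ∀ x r c → x * c ≡ r * c + (x - r) * c
  lemma = solve-∀
Degree≤-x* {g = g} dg@(factor h) = factor λ r →
  let q , dq , e = h r in
  (λ x → g x + r * q x) , Degree≤-+ dg (Degree≤-suc (Degree≤-scale r dq)) ,
  λ x → trans (lemma₁ x r (g x)) (trans (cong (λ y → r * y + (x - r) * g x) (e x)) (lemma₂ x r (g x) (g r) (q x)))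
  where
  lemma₁ : ∀ x r a → x * a ≡ r * a + (x - r) * a
  lemma₁ = solve-∀
  lemma₂ : ∀ x r a b u → r * (b + (x - r) * u) + (x - r) * a ≡ r * b + (x - r) * (a + r * u)
  lemma₂ = solve-∀

Degree≤-^ : ∀ n → Degree≤ n (_^ n)
Degree≤-^ zero    = constant (+ 1) λ _ → refl
Degree≤-^ (suc n) = Degree≤-x* (Degree≤-^ n)

Degree≤-const : ∀ n c → Degree≤ n (λ _ → c)
Degree≤-const zero    c = constant c λ _ → refl
Degree≤-const (suc n) c = Degree≤-suc (Degree≤-const n c)

-- Arithmetic modulo a prime

module PrimeMod (n : ℕ) (pp : Prime (suc n)) where

  open Mod (+ suc n) public
  module ≈-Reasoning = SetoidReasoning ≈-setoid

  p : ℕ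
  p = suc n

  ≈0⇒∣∣∣ : ∀ {x} → x ≈ + 0 → p ℕDiv.∣ ∣ x ∣
  ≈0⇒∣∣∣ h = Signed.∣⇒∣ᵤ (≈0⇒∣ h)

  ∣∣∣⇒≈0 : ∀ {x} → p ℕDiv.∣ ∣ x ∣ → x ≈ + 0
  ∣∣∣⇒≈0 {x} h = ∣⇒≈0 (Signed.∣ᵤ⇒∣ {+ p} {x} h)

  +suc≉0 : ∀ {k} → suc k ℕ.< p → ¬ (+ suc k ≈ + 0)
  +suc≉0 k<p h = ℕP.<⇒≱ k<p (ℕDiv.∣⇒≤ (≈0⇒∣∣∣ h))

  *≈0 : ∀ x y → x * y ≈ + 0 → x ≈ + 0 ⊎ y ≈ + 0
  *≈0 x y h with euclidsLemma ∣ x ∣ ∣ y ∣ pp (subst (p ℕDiv.∣_) (ℤP.abs-* x y) (≈0⇒∣∣∣ h))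
  ... | inj₁ d = inj₁ (∣∣∣⇒≈0 d)
  ... | inj₂ d = inj₂ (∣∣∣⇒≈0 d)

  *-cancelˡ-≈ : ∀ x {y z} → ¬ (x ≈ + 0) → x * y ≈ x * z → y ≈ z
  *-cancelˡ-≈ x {y} {z} x≉0 h = [ (λ x≈0 → ⊥-elim (x≉0 x≈0)) , -≈0⇒≈ ]′
    (*≈0 x (y - z) (≈-trans (≡⇒≈ (lemma x y z)) (≈⇒-≈0 h)))
    where
    lemma : ∀ x y z → x * (y - z) ≡ x * y - x * z
    lemma = solve-∀

  -- Absorption gives (k+1) C(p,k+1) = p C(p-1,k), and k+1 is invertible modulo p.
  pCk≈0 : ∀ {k} → k ℕ.< n → + (p C suc k) ≈ + 0
  pCk≈0 {k} k<n = [ (λ h → ⊥-elim (+suc≉0 (s≤s k<n) h)) , (λ h → h) ]′ (*≈0 (+ suc k) (+ (p C suc k))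
    (≈-trans (≡⇒≈ (trans (sym (ℤP.pos-* (suc k) _)) (trans (cong +_ (absorption n k)) (ℤP.pos-* p _))))
             (m*≈0 (+ (n C k)))))

  B-p : ∀ f → B f p ≈ f 0 + f p
  B-p f = begin
    B f p
      ≡⟨ B-∑ f (ℕP.n<1+n p) ⟩
    + 1 * f 0 + ∑ (λ j → + (p C suc j) * f (suc j)) p
      ≡⟨ cong₂ _+_ (ℤP.*-identityˡ (f 0)) (∑-snoc (λ j → + (p C suc j) * f (suc j)) n) ⟩
    f 0 + (∑ (λ j → + (p C suc j) * f (suc j)) n + + (p C p) * f p)
      ≈⟨ +-congˡ (f 0) (+-cong (∑-cong n λ k k<n → *-congʳ (f (suc k)) (pCk≈0 k<n))
           (≡⇒≈ (trans (cong (λ c → + c * f p) (nCn≡1 p)) (ℤP.*-identityˡ (f p))))) ⟩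
    f 0 + (∑ (λ j → + 0 * f (suc j)) n + f p)
      ≡⟨ cong (λ x → f 0 + (x + f p)) (∑-zero (f ∘ suc) n) ⟩
    f 0 + (+ 0 + f p)
      ≡⟨ cong (_+_ (f 0)) (ℤP.+-identityˡ (f p)) ⟩
    f 0 + f p ∎
    where
    open ≈-Reasoning

  frobenius : ∀ x → (+ 1 + x) ^ p ≈ + 1 + x ^ p
  frobenius x = ≈-trans (≡⇒≈ (sym (B-geometric x p))) (B-p (x ^_))

  -- Induction away from 0 in both directions. For negative x, `frobenius` is read backwards: x^p ≡
  -- -1 + (1+x)^p moves x towards 0.
  fermat : ∀ x → x ^ p ≈ x
  fermat (+ zero)     = ≈-refl
  fermat (+ suc a)    = ≈-trans (frobenius (+ a)) (+-congˡ (+ 1) (fermat (+ a)))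
  fermat -[1+ zero ]  = ≈-trans (≡⇒≈ (lemma _)) (+-congˡ (- + 1) (≈-sym (frobenius (- + 1))))
    where
    lemma : ∀ x → x ≡ - + 1 + (+ 1 + x)
    lemma = solve-∀
  fermat -[1+ suc a ] = ≈-trans (≡⇒≈ (lemma _)) (+-congˡ (- + 1) (≈-trans (≈-sym (frobenius -[1+ suc a ])) (fermat -[1+ a ])))
    where
    lemma : ∀ x → x ≡ - + 1 + (+ 1 + x)
    lemma = solve-∀

  fermat-unit : ∀ x → ¬ (x ≈ + 0) → x ^ n ≈ + 1
  fermat-unit x x≉0 = *-cancelˡ-≈ x x≉0 (≈-trans (fermat x) (≡⇒≈ (sym (ℤP.*-identityʳ x))))

  -- Lagrange's argument: dividing out `r 0` leaves a quotient which, by primality, vanishes at the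
  -- other roots, hence everywhere by induction. Vanishing at every integer stands in for vanishing
  -- coefficients, as polynomials are only functions here.
  too-many-roots : ∀ {d g} → Degree≤ d g → (r : ℕ → ℤ) →
    (∀ {i j} → i ℕ.< j → j ℕ.≤ d → ¬ (r j ≈ r i)) → (∀ {i} → i ℕ.≤ d → g (r i) ≈ + 0) → ∀ x → g x ≈ + 0
  too-many-roots (constant c g≡c) r _ root x = ≈-trans (≡⇒≈ (trans (g≡c x) (sym (g≡c (r 0))))) (root z≤n)
  too-many-roots {suc d} {g} (factor h) r distinct root x with h (r 0)
  ... | q , dq , e = begin
    g x                         ≡⟨ e x ⟩
    g (r 0) + (x - r 0) * q x   ≈⟨ +-cong (root z≤n) (*-congˡ (x - r 0) (q≈0 x)) ⟩
    + 0 + (x - r 0) * + 0       ≡⟨ lemma (x - r 0) ⟩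
    + 0                         ∎
    where
    open ≈-Reasoning
    lemma : ∀ y → + 0 + y * + 0 ≡ + 0
    lemma = solve-∀
    root′ : ∀ {i} → i ℕ.≤ d → q (r (suc i)) ≈ + 0
    root′ {i} i≤d = [ (λ ri≈r0 → ⊥-elim (distinct (s≤s z≤n) (s≤s i≤d) (-≈0⇒≈ ri≈r0))) , (λ qri≈0 → qri≈0) ]′
      (*≈0 (r (suc i) - r 0) (q (r (suc i))) (begin
        (r (suc i) - r 0) * q (r (suc i))               ≡⟨ ℤP.+-identityˡ _ ⟨
        + 0 + (r (suc i) - r 0) * q (r (suc i))         ≈⟨ +-congʳ ((r (suc i) - r 0) * q (r (suc i))) (≈-sym (root z≤n)) ⟩
        g (r 0) + (r (suc i) - r 0) * q (r (suc i))     ≡⟨ e (r (suc i)) ⟨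
        g (r (suc i))                                   ≈⟨ root (s≤s i≤d) ⟩
        + 0                                             ∎))
    q≈0 : ∀ x → q x ≈ + 0
    q≈0 = too-many-roots dq (r ∘ suc) (λ i<j j≤d → distinct (s≤s i<j) (s≤s j≤d)) root′

module OddPrimeMod (m : ℕ) (pp : Prime (suc (2 ℕ.* m))) where

  open PrimeMod (2 ℕ.* m) pp public

  m>0 : 0 ℕ.< m
  m>0 = go m pp
    where
    go : ∀ m → Prime (suc (2 ℕ.* m)) → 0 ℕ.< m
    go zero    ()
    go (suc m) _ = s≤s z≤n

  m<p : m ℕ.< p
  m<p = s≤s (ℕP.m≤m+n m (m ℕ.+ 0))

  m+1<p : suc m ℕ.< p
  m+1<p = s≤s (subst (ℕ._≤ 2 ℕ.* m) (ℕP.+-comm m 1) (ℕP.+-monoʳ-≤ m (ℕP.≤-trans m>0 (ℕP.m≤m+n m 0))))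

  2≉0 : ¬ (+ 2 ≈ + 0)
  2≉0 = +suc≉0 (ℕP.≤-<-trans (s≤s m>0) m+1<p)

  1≉0 : ¬ (+ 1 ≈ + 0)
  1≉0 = +suc≉0 (ℕP.≤-<-trans m>0 m<p)

  0^m≈0 : (+ 0) ^ m ≈ + 0
  0^m≈0 = go m m>0
    where
    go : ∀ m → 0 ℕ.< m → (+ 0) ^ m ≈ + 0
    go (suc m) _ = ≈-refl

  square^m : ∀ x → (x * x) ^ m ≡ x ^ (2 ℕ.* m)
  square^m x = trans (cong (_^ m) (cong (_*_ x) (sym (ℤP.*-identityʳ x)))) (ℤP.^-*-assoc x 2 m)

  square-unit : ∀ x → ¬ (x ≈ + 0) → (x * x) ^ m ≈ + 1
  square-unit x x≉0 = ≈-trans (≡⇒≈ (square^m x)) (fermat-unit x x≉0)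

  -- a^m = 1 and a not a square would give X^m - 1 the m + 1 roots a, 1², …, m².
  nonsquare : ∀ a → (∀ x → x ℕ.< p → ¬ (+ x * + x ≈ a)) → ¬ (a ^ m ≈ + 1)
  -- Evaluation at 0 gives 0^m ≡ 1, contrary to m > 0.
  nonsquare a ns a^m≈1 = 1≉0 (≈-trans (≈-sym (-≈0⇒≈ (too-many-roots degree r distinct root (+ 0)))) 0^m≈0)
    where
    r : ℕ → ℤ
    r zero    = a
    r (suc i) = + suc i * + suc i
    degree : Degree≤ m (λ x → x ^ m + - + 1)
    degree = Degree≤-+ (Degree≤-^ m) (Degree≤-const m (- + 1))
    root : ∀ {i} → i ℕ.≤ m → r i ^ m + - + 1 ≈ + 0
    root {zero}  _   = +-congʳ (- + 1) a^m≈1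
    root {suc i} i≤m = +-congʳ (- + 1) (square-unit (+ suc i) (+suc≉0 (ℕP.≤-<-trans i≤m m<p)))
    distinct : ∀ {i j} → i ℕ.< j → j ℕ.≤ m → ¬ (r j ≈ r i)
    distinct {zero}  {suc j} _   j≤m h = ns (suc j) (ℕP.≤-<-trans j≤m m<p) h
    distinct {suc i} {suc j} i<j j≤m h with ℕP.m≤n⇒∃[o]m+o≡n i<j
    -- The difference of the two squares is the product of the difference and the sum of `suc j` and
    -- `suc i`; both factors are positive and below p = 2m + 1.
    ... | k , refl = [ +suc≉0 (ℕP.≤-<-trans (ℕP.≤-trans (s≤s (ℕP.m≤n+m k (suc i))) j≤m) m<p)
                     , +suc≉0 (s≤s (ℕP.≤-trans (ℕP.≤-reflexive (sum i k))
                         (ℕP.+-mono-≤ (ℕP.<⇒≤ (ℕP.<-≤-trans i<j j≤m)) (ℕP.≤-trans j≤m (ℕP.m≤m+n m 0)))))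
                     ]′ (*≈0 (+ suc k) (+ suc (suc i) + + (i ℕ.+ suc k)) (≈-trans (≡⇒≈ (factorise (+ i) (+ k))) (≈⇒-≈0 h)))
      where
      factorise : ∀ i k → (+ 1 + k) * ((+ 2 + i) + (i + (+ 1 + k)))
              ≡ (+ 2 + (i + k)) * (+ 2 + (i + k)) - (+ 1 + i) * (+ 1 + i)
      factorise = solve-∀
      sum : ∀ i k → suc (suc i ℕ.+ (i ℕ.+ suc k)) ≡ suc i ℕ.+ suc (suc i ℕ.+ k)
      sum = ℕR.solve-∀

  -- For a unit square this is Fermat. Otherwise (a^m - 1)(a^m + 1) = a^(2m) - 1 ≡ 0, and
  -- `nonsquare` excludes the first factor.
  euler : ∀ a → a ^ m ≈ legendre a p
  euler a with (+ p) ∣ℤ? a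
  ... | yes p∣a = ≈-trans (^-cong m (∣∣∣⇒≈0 p∣a)) 0^m≈0
  ... | no p∤a with any? (λ x → (+ p) ∣ℤ? ((+ x) * (+ x) - a)) (upTo p)
  ...   | yes e = let x , h = satisfied e in
                  ≈-trans (^-cong m (≈-sym (≡[mod]⇒≈ {+ x * + x} {a} h))) (square-unit (+ x) λ x≈0 →
                    p∤a (≈0⇒∣∣∣ (≈-trans (≈-sym (≡[mod]⇒≈ {+ x * + x} {a} h)) (≈-trans (*-congʳ (+ x) x≈0) ≈-refl))))
  ...   | no ¬e = [ (λ h → ⊥-elim (nonsquare a (λ x x<p x²≈a → ¬e (lose (∈-upTo⁺ x<p) (≈⇒≡[mod] x²≈a))) (-≈0⇒≈ h)))
                  , (λ h → -≈0⇒≈ h) ]′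
                  (*≈0 (a ^ m - + 1) (a ^ m - - + 1) (begin
                    (a ^ m - + 1) * (a ^ m - - + 1)  ≡⟨ lemma (a ^ m) ⟩
                    a ^ m * a ^ m - + 1              ≡⟨ cong (_- + 1) (^-distribʳ-* a a m) ⟨
                    (a * a) ^ m - + 1                ≈⟨ +-congʳ (- + 1) (square-unit a (λ a≈0 → p∤a (≈0⇒∣∣∣ a≈0))) ⟩
                    + 0                              ∎))
    where
    open ≈-Reasoning
    lemma : ∀ x → (x - + 1) * (x - - + 1) ≡ x * x - + 1
    lemma = solve-∀

-- The quadratic character of -3

-- w j is the first coordinate of (-ω)^j in the basis 1, -ω of ℤ[ω], so B w n is that of (1 - ω)^n, and (1 - ω)^6 = -27.
w : ℕ → ℤ
w 0 = + 1
w 1 = + 0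
w 2 = - + 1
w 3 = - + 1
w 4 = + 0
w 5 = + 1
w (suc (suc (suc (suc (suc (suc j)))))) = w j

-- The number -ω is a root of z² = z - 1.
w-rec : ∀ j → w (2 ℕ.+ j) ≡ w (suc j) + (- + 1) * w j
w-rec 0 = refl
w-rec 1 = refl
w-rec 2 = refl
w-rec 3 = refl
w-rec 4 = refl
w-rec 5 = refl
w-rec (suc (suc (suc (suc (suc (suc j)))))) = w-rec j

-- The number 1 - ω is a root of z² = 3z - 3.
B-w-rec : ∀ n → B w (2 ℕ.+ n) ≡ + 3 * B w (suc n) - + 3 * B w n
B-w-rec n = trans (lemma₁ (B w n) (B w (suc n)) (B w (2 ℕ.+ n)))
    (trans (cong (λ x → x + + 2 * B w (suc n) - B w n) (trans (sym (B-Δ² w n)) (trans (B-ext n w-rec)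
      (trans (B-+ (w ∘ suc) (λ j → (- + 1) * w j) n) (cong (_+_ (B (w ∘ suc) n)) (B-* (- + 1) w n))))))
    (lemma₂ (B w n) (B (w ∘ suc) n)))
  where
  lemma₁ : ∀ a b c → c ≡ (c - + 2 * b + a) + + 2 * b - a
  lemma₁ = solve-∀
  lemma₂ : ∀ a d → (d + (- + 1) * a) + + 2 * (a + d) - a ≡ + 3 * (a + d) - + 3 * a
  lemma₂ = solve-∀

B-w-6+ : ∀ n → B w (6 ℕ.+ n) ≡ (- + 27) * B w n
B-w-6+ n = trans (B-w-rec (4 ℕ.+ n)) (lemma (B w n) (B w (1 ℕ.+ n)) (B-w-rec n) (B-w-rec (1 ℕ.+ n)) (B-w-rec (2 ℕ.+ n)) (B-w-rec (3 ℕ.+ n)))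
  where
  poly : ∀ a b → let c = + 3 * b - + 3 * a ; d = + 3 * c - + 3 * b ; e = + 3 * d - + 3 * c ; f = + 3 * e - + 3 * d in
                 + 3 * f - + 3 * e ≡ (- + 27) * a
  poly = solve-∀
  lemma : ∀ a b {c d e f} → c ≡ + 3 * b - + 3 * a → d ≡ + 3 * c - + 3 * b → e ≡ + 3 * d - + 3 * c → f ≡ + 3 * e - + 3 * d →
          + 3 * f - + 3 * e ≡ (- + 27) * a
  lemma a b refl refl refl refl = poly a b

B-w-periodic : ∀ q r → B w (q ℕ.* 6 ℕ.+ r) ≡ (- + 27) ^ q * B w r
B-w-periodic zero    r = sym (ℤP.*-identityˡ (B w r))
B-w-periodic (suc q) r = trans (B-w-6+ (q ℕ.* 6 ℕ.+ r))
  (trans (cong (_*_ (- + 27)) (B-w-periodic q r)) (sym (ℤP.*-assoc (- + 27) ((- + 27) ^ q) (B w r))))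

w-periodic : ∀ q r → w (q ℕ.* 6 ℕ.+ r) ≡ w r
w-periodic zero    r = refl
w-periodic (suc q) r = w-periodic q r

[-3]^[q*3] : ∀ q → (- + 3) ^ (q ℕ.* 3) ≡ (- + 27) ^ q
[-3]^[q*3] q = trans (cong ((- + 3) ^_) (ℕP.*-comm q 3)) (sym (ℤP.^-*-assoc (- + 3) 3 q))

data Sign : ℤ → Set where
  zero     : Sign (+ 0)
  positive : Sign (+ 1)
  negative : Sign (- + 1)

legendre-sign : ∀ a p → Sign (legendre a p)
legendre-sign a p with (+ p) ∣ℤ? a
... | yes _ = zero
... | no  _ with any? (λ x → (+ p) ∣ℤ? ((+ x) * (+ x) - a)) (upTo p)
...   | yes _ = positive
...   | no  _ = negative

module Mod3 = OddPrimeMod 1 (from-yes (prime? 3))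

-- The values 0, 1 and -1 are pairwise incongruent modulo 3, so a congruence modulo 3 determines the
-- symbol.
Sign-≈⇒≡ : ∀ {x y} → Sign x → Sign y → x Mod3.≈ y → x ≡ y
Sign-≈⇒≡ sx sy h = go sx sy (Mod3.≈⇒≡[mod] h)
  where
  ¬3∣1 = from-no (3 ℕDiv.∣? 1)
  ¬3∣2 = from-no (3 ℕDiv.∣? 2)
  go : ∀ {x y} → Sign x → Sign y → x ≡ y [mod + 3 ] → x ≡ y
  go zero     zero     d = refl
  go zero     positive d = ⊥-elim (¬3∣1 d)
  go zero     negative d = ⊥-elim (¬3∣1 d)
  go positive zero     d = ⊥-elim (¬3∣1 d)
  go positive positive d = refl
  go positive negative d = ⊥-elim (¬3∣2 d)
  go negative zero     d = ⊥-elim (¬3∣1 d)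
  go negative positive d = ⊥-elim (¬3∣2 d)
  go negative negative d = refl

-- At the prime 3 the exponent in Euler's criterion is 1, so the symbol is congruent to its
-- argument.
legendre-3 : ∀ p {s} → Sign s → + p Mod3.≈ s → legendre (+ p) 3 ≡ s
legendre-3 p ss h = Sign-≈⇒≡ (legendre-sign (+ p) 3) ss
  (Mod3.≈-trans (Mod3.≈-sym (Mod3.euler (+ p))) (Mod3.≈-trans (Mod3.≡⇒≈ (ℤP.*-identityʳ (+ p))) h))

data Residue3 : ℕ → Set where
  residue : ∀ q r → r ℕ.< 3 → Residue3 (q ℕ.* 3 ℕ.+ r)

residue3 : ∀ n → Residue3 n
residue3 n = subst Residue3 (sym (trans (ℕD.m≡m%n+[m/n]*n n 3) (ℕP.+-comm (n ℕD.% 3) _))) (residue (n ℕD./ 3) (n ℕD.% 3) (ℕD.m%n<n n 3))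

-- Evaluation of S(p)/p modulo p = 2m + 1

module SModPrime (m : ℕ) (pp : Prime (suc (2 ℕ.* m))) where

  open OddPrimeMod m pp
  open ≈-Reasoning

  -- Writing m = 3q + r gives p = 6q + (1 + 2r). Both sides of `B-p w` then reduce by their period
  -- 6, to (-27)^q `B w (1 + 2r)` and 1 + `w (1 + 2r)`, with (-3)^m = (-27)^q (-3)^r.
  [-3]^m : (- + 3) ^ m ≈ legendre (+ p) 3
  [-3]^m = go (residue3 m) refl
    where
    go : ∀ {k} → Residue3 k → m ≡ k → (- + 3) ^ m ≈ legendre (+ p) 3
    go (residue q r r<3) m≡ = cases r r<3 refl
      where
      p≡ : p ≡ q ℕ.* 6 ℕ.+ (1 ℕ.+ 2 ℕ.* r)
      p≡ = trans (cong (λ m → suc (2 ℕ.* m)) m≡) (lemma q r)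
        where
        lemma : ∀ q r → suc (2 ℕ.* (q ℕ.* 3 ℕ.+ r)) ≡ q ℕ.* 6 ℕ.+ (1 ℕ.+ 2 ℕ.* r)
        lemma = ℕR.solve-∀
      p≈₃ : + p Mod3.≈ + (1 ℕ.+ 2 ℕ.* r)
      p≈₃ = (+ q * + 2) Mod3.≈by trans (cong +_ p≡) (trans (cong (_+ + (1 ℕ.+ 2 ℕ.* r)) (ℤP.pos-* q 6)) (lemma (+ q) (+ (1 ℕ.+ 2 ℕ.* r))))
        where
        lemma : ∀ q s → q * + 6 + s ≡ s + (q * + 2) * + 3
        lemma = solve-∀
      x = (- + 27) ^ q
      [-3]^m≡ : (- + 3) ^ m ≡ x * (- + 3) ^ r
      [-3]^m≡ = trans (cong ((- + 3) ^_) m≡) (trans (ℤP.^-distribˡ-+-* (- + 3) (q ℕ.* 3) r) (cong (_* (- + 3) ^ r) ([-3]^[q*3] q)))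
      x-eq : x * B w (1 ℕ.+ 2 ℕ.* r) ≈ + 1 + w (1 ℕ.+ 2 ℕ.* r)
      x-eq = begin
        x * B w (1 ℕ.+ 2 ℕ.* r)                ≡⟨ B-w-periodic q (1 ℕ.+ 2 ℕ.* r) ⟨
        B w (q ℕ.* 6 ℕ.+ (1 ℕ.+ 2 ℕ.* r))      ≡⟨ cong (B w) p≡ ⟨
        B w p                                  ≈⟨ B-p w ⟩
        + 1 + w p                              ≡⟨ cong (λ j → + 1 + w j) p≡ ⟩
        + 1 + w (q ℕ.* 6 ℕ.+ (1 ℕ.+ 2 ℕ.* r))  ≡⟨ cong (_+_ (+ 1)) (w-periodic q (1 ℕ.+ 2 ℕ.* r)) ⟩
        + 1 + w (1 ℕ.+ 2 ℕ.* r)                ∎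
      cases : ∀ s → s ℕ.< 3 → r ≡ s → (- + 3) ^ m ≈ legendre (+ p) 3
      cases 0 _ refl = begin
        (- + 3) ^ m       ≡⟨ [-3]^m≡ ⟩
        x * + 1           ≈⟨ x-eq ⟩
        + 1               ≡⟨ legendre-3 p positive p≈₃ ⟨
        legendre (+ p) 3  ∎
      -- Here 3 divides p, so p = 3 and both sides vanish.
      cases 1 _ refl = begin
        (- + 3) ^ m       ≡⟨ [-3]^m≡ ⟩
        x * (- + 3)       ≈⟨ *-congˡ x -3≈0 ⟩
        x * + 0           ≡⟨ ℤP.*-zeroʳ x ⟩
        + 0               ≡⟨ legendre-3 p zero p≈₃0 ⟨
        legendre (+ p) 3  ∎
        where
        p≈₃0 : + p Mod3.≈ + 0
        p≈₃0 = Mod3.≈-trans p≈₃ (+ 1 Mod3.≈by refl)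
        3≡p : 3 ≡ p
        3≡p = [ (λ ()) , (λ e → e) ]′ (prime⇒irreducible pp (Mod3.≈0⇒∣∣∣ p≈₃0))
        -3≈0 : - + 3 ≈ + 0
        -3≈0 = (- + 1) ≈by cong (λ k → + 0 + (- + 1) * + k) 3≡p
      -- `B w 5` is -18 and 1 + `w 5` is 2; cancelling -2 leaves 9 (-27)^q ≡ -1.
      cases 2 _ refl = ≈-trans (*-cancelˡ-≈ (- + 2) (λ h → 2≉0 (-≈0⇒≈ {+ 2} {+ 0} (≈-trans (*-congˡ (- + 1) h) ≈-refl))) (begin
        (- + 2) * (- + 3) ^ m      ≡⟨ cong (_*_ (- + 2)) [-3]^m≡ ⟩
        (- + 2) * (x * + 9)        ≡⟨ lemma x ⟩
        x * (- + 18)               ≈⟨ x-eq ⟩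
        (- + 2) * (- + 1)          ∎))
        (≡⇒≈ (sym (legendre-3 p negative (Mod3.≈-trans p≈₃ (+ 2 Mod3.≈by refl)))))
        where
        lemma : ∀ x → (- + 2) * (x * + 9) ≡ x * (- + 18)
        lemma = solve-∀
      cases (suc (suc (suc _))) (s≤s (s≤s (s≤s ()))) _

  -- Integer powers are kept up to the last step, because the relations χ² = 1 and ε χ = t hold
  -- exactly for them.
  χ t ε : ℤ
  χ = (- + 1) ^ m
  t = (+ 3) ^ m
  ε = (- + 3) ^ m

  χ²≡1 : χ * χ ≡ + 1
  χ²≡1 = trans (sym (^-distribʳ-* (- + 1) (- + 1) m)) (ℤP.^-zeroˡ m)

  χt≡ε : χ * t ≡ ε
  χt≡ε = sym (^-distribʳ-* (- + 1) (+ 3) m)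

  εχ≡t : ε * χ ≡ t
  εχ≡t = trans (cong (_* χ) (sym χt≡ε)) (trans (lemma χ t) (trans (cong (_* t) χ²≡1) (ℤP.*-identityˡ t)))
    where
    lemma : ∀ x y → (x * y) * x ≡ (x * x) * y
    lemma = solve-∀

  [-4]^m≈χ : (- + 4) ^ m ≈ χ
  [-4]^m≈χ = begin
    (- + 4) ^ m            ≡⟨ ^-distribʳ-* (- + 1) (+ 4) m ⟩
    χ * (+ 2 * + 2) ^ m    ≈⟨ *-congˡ χ (square-unit (+ 2) 2≉0) ⟩
    χ * + 1                ≡⟨ ℤP.*-identityʳ χ ⟩
    χ                      ∎

  -- 1/2 = m + 1 modulo p, and ratio k = -(-4)^k (1/2 choose k).
  u : ℕ → ℤ
  u k = + (suc m C k) * (- + 4) ^ k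

  -- Both sides satisfy first-order recurrences with divisor k+1, and their factors 2(2k-1) and
  -- -4(m+1-k) differ by 2(2m+1) = 2p. The bound on k keeps the divisor invertible.
  ratio≈ : ∀ k → k ℕ.≤ suc m → ratio k ≈ - u k
  ratio≈ zero    _   = ≈-refl
  ratio≈ (suc k) k<M = *-cancelˡ-≈ (+ suc k) (+suc≉0 (ℕP.≤-<-trans k<M m+1<p)) (begin
    + suc k * ratio (suc k)
      ≡⟨ ratio-rec k ⟩
    + 2 * (+ 2 * + k - + 1) * ratio k
      ≈⟨ *-congˡ (+ 2 * (+ 2 * + k - + 1)) (ratio≈ k (ℕP.<⇒≤ k<M)) ⟩
    + 2 * (+ 2 * + k - + 1) * - (c * v)
      ≡⟨ ℤP.+-identityʳ _ ⟨
    + 2 * (+ 2 * + k - + 1) * - (c * v) + + 0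
      ≈⟨ +-congˡ (+ 2 * (+ 2 * + k - + 1) * - (c * v)) (≈-sym (m*≈0 (+ 2 * (c * v)))) ⟩
    + 2 * (+ 2 * + k - + 1) * - (c * v) + + p * (+ 2 * (c * v))
      ≡⟨ cong (λ y → + 2 * (+ 2 * + k - + 1) * - (c * v) + y * (+ 2 * (c * v))) (+2k+1 m) ⟩
    + 2 * (+ 2 * + k - + 1) * - (c * v) + (+ 1 + + 2 * + m) * (+ 2 * (c * v))
      ≡⟨ lemma₁ (+ k) (+ m) c v ⟩
    ((+ suc m - + k) * c) * (+ 4 * v)
      ≡⟨ cong (_* (+ 4 * v)) (absorption-ℤ (suc m) k) ⟨
    (+ suc k * + (suc m C suc k)) * (+ 4 * v)
      ≡⟨ lemma₂ (+ suc k) (+ (suc m C suc k)) v ⟩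
    + suc k * - (+ (suc m C suc k) * ((- + 4) * v)) ∎)
    where
    c = + (suc m C k)
    v = (- + 4) ^ k
    lemma₁ : ∀ k m c v → + 2 * (+ 2 * k - + 1) * - (c * v) + (+ 1 + + 2 * m) * (+ 2 * (c * v))
                       ≡ ((+ 1 + m - k) * c) * (+ 4 * v)
    lemma₁ = solve-∀
    lemma₂ : ∀ k c v → (k * c) * (+ 4 * v) ≡ k * - (c * ((- + 4) * v))
    lemma₂ = solve-∀

  ratio[m+1] : ratio (suc m) ≈ + 4 * χ
  ratio[m+1] = begin
    ratio (suc m)                                ≈⟨ ratio≈ (suc m) ℕP.≤-refl ⟩
    - (+ (suc m C suc m) * ((- + 4) * (- + 4) ^ m))  ≡⟨ cong (λ c → - (+ c * ((- + 4) * (- + 4) ^ m))) (nCn≡1 (suc m)) ⟩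
    - (+ 1 * ((- + 4) * (- + 4) ^ m))            ≡⟨ lemma ((- + 4) ^ m) ⟩
    + 4 * (- + 4) ^ m                            ≈⟨ *-congˡ (+ 4) [-4]^m≈χ ⟩
    + 4 * χ                                      ∎
    where
    lemma : ∀ x → - (+ 1 * ((- + 4) * x)) ≡ + 4 * x
    lemma = solve-∀

  -- With the additional term k = m+1 the sum is congruent to minus the complete expansion of
  -- (1-4)^(m+1), that is to 3ε; the added term is 4χ.
  ∑ratio : ∑ ratio (suc m) ≈ + 3 * ε - + 4 * χ
  ∑ratio = begin
    ∑ ratio (suc m)
      ≡⟨ lemma₁ (∑ ratio (suc m)) (ratio (suc m)) ⟩
    (∑ ratio (suc m) + ratio (suc m)) + (- + 1) * ratio (suc m)
      ≡⟨ cong (_+ (- + 1) * ratio (suc m)) (∑-snoc ratio (suc m)) ⟨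
    ∑ ratio (2 ℕ.+ m) + (- + 1) * ratio (suc m)
      ≈⟨ +-cong (∑-cong (2 ℕ.+ m) λ { k (s≤s k≤M) → ratio≈ k k≤M }) (*-congˡ (- + 1) ratio[m+1]) ⟩
    ∑ (λ k → - u k) (2 ℕ.+ m) + (- + 1) * (+ 4 * χ)
      ≡⟨ cong (_+ (- + 1) * (+ 4 * χ)) (trans (∑-neg u (2 ℕ.+ m))
           (cong -_ (trans (sym (B-∑ ((- + 4) ^_) (ℕP.n<1+n (suc m)))) (B-geometric (- + 4) (suc m))))) ⟩
    - ((- + 3) * ε) + (- + 1) * (+ 4 * χ)
      ≡⟨ lemma₂ ε χ ⟩
    + 3 * ε - + 4 * χ ∎
    where
    lemma₁ : ∀ a b → a ≡ (a + b) + (- + 1) * b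
    lemma₁ = solve-∀
    lemma₂ : ∀ e c → - ((- + 3) * e) + (- + 1) * (+ 4 * c) ≡ + 3 * e - + 4 * c
    lemma₂ = solve-∀

  -- Neighbours C(p-1,j) and C(p-1,j+1) add up to C(p,j+1) ≡ 0, so the entries alternate in sign and
  -- two steps restore 1.
  [p-1]C[2k]≈1 : ∀ k → k ℕ.≤ m → + ((2 ℕ.* m) C (2 ℕ.* k)) ≈ + 1
  [p-1]C[2k]≈1 zero    _   = ≈-refl
  [p-1]C[2k]≈1 (suc k) k<m = begin
    + (n C (2 ℕ.* suc k))                   ≡⟨ cong (λ j → + (n C j)) (2*suc k) ⟩
    + (n C (2 ℕ.+ j))                       ≡⟨ lemma₁ (+ (n C suc j)) (+ (n C (2 ℕ.+ j))) ⟩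
    (+ (n C suc j) + + (n C (2 ℕ.+ j))) + (- + 1) * + (n C suc j)
                                            ≈⟨ +-congʳ ((- + 1) * + (n C suc j)) (pascal (suc j) j+1<n) ⟩
    + 0 + (- + 1) * + (n C suc j)           ≡⟨ lemma₂ (+ (n C j)) (+ (n C suc j)) ⟩
    + (n C j) + (- + 1) * (+ (n C j) + + (n C suc j))
                                            ≈⟨ +-cong ([p-1]C[2k]≈1 k (ℕP.<⇒≤ k<m)) (*-congˡ (- + 1) (pascal j (ℕP.<⇒≤ j+1<n))) ⟩
    + 1                                     ∎
    where
    n = 2 ℕ.* m
    j = 2 ℕ.* k
    j+1<n : suc j ℕ.< n
    j+1<n = subst (ℕ._≤ n) (2*suc k) (ℕP.*-monoʳ-≤ 2 k<m)
    pascal : ∀ j → j ℕ.< n → + (n C j) + + (n C suc j) ≈ + 0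
    pascal j j<n = ≈-trans (≡⇒≈ (cong +_ (nCk+nC[k+1]≡[n+1]C[k+1] n j))) (pCk≈0 j<n)
    lemma₁ : ∀ a b → b ≡ (a + b) + (- + 1) * a
    lemma₁ = solve-∀
    lemma₂ : ∀ a b → + 0 + (- + 1) * b ≡ a + (- + 1) * (a + b)
    lemma₂ = solve-∀

  W[p-1] : W (2 ℕ.* m) ≈ + 3 * ε - + 4 * χ
  W[p-1] = begin
    W (2 ℕ.* m)
      ≡⟨ W≡∑ (2 ℕ.* m) ⟩
    ∑ (λ k → + ((2 ℕ.* m) C (2 ℕ.* k)) * ratio k) (suc ((2 ℕ.* m) ℕD./ 2))
      ≡⟨ cong (λ j → ∑ (λ k → + ((2 ℕ.* m) C (2 ℕ.* k)) * ratio k) (suc j)) (trans (cong (ℕD._/ 2) (ℕP.*-comm 2 m)) (ℕD.m*n/n≡m m 2)) ⟩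
    ∑ (λ k → + ((2 ℕ.* m) C (2 ℕ.* k)) * ratio k) (suc m)
      ≈⟨ ∑-cong (suc m) (λ { k (s≤s k≤m) → ≈-trans (*-congʳ (ratio k) ([p-1]C[2k]≈1 k k≤m)) (≡⇒≈ (ℤP.*-identityˡ (ratio k))) }) ⟩
    ∑ ratio (suc m)
      ≈⟨ ∑ratio ⟩
    + 3 * ε - + 4 * χ ∎

  W[p] : W p ≈ - + 1
  W[p] = begin
    W p          ≡⟨ W≡B p ⟩
    B φ p        ≈⟨ B-p φ ⟩
    - + 1 + φ p  ≡⟨ cong (_+_ (- + 1)) (spread-odd ratio m) ⟩
    - + 1        ∎

  W[p+1] : W (suc p) ≈ - + 1 + + 4 * χ
  W[p+1] = begin
    W (suc p)                        ≡⟨ W≡B (suc p) ⟩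
    B φ p + B (φ ∘ suc) p            ≈⟨ +-cong (≈-trans (≡⇒≈ (sym (W≡B p))) W[p]) (B-p (φ ∘ suc)) ⟩
    - + 1 + (+ 0 + φ (suc p))        ≡⟨ cong (λ x → - + 1 + (+ 0 + x)) (spread-even (ratio ∘ suc) m) ⟩
    - + 1 + (+ 0 + ratio (suc m))    ≡⟨ cong (_+_ (- + 1)) (ℤP.+-identityˡ (ratio (suc m))) ⟩
    - + 1 + ratio (suc m)            ≈⟨ +-congˡ (- + 1) ratio[m+1] ⟩
    - + 1 + + 4 * χ                  ∎

  X≈ : ∀ n {a b} → W n ≈ a → W (suc n) ≈ b → X n ≈ b + (- + 3) * a
  X≈ n {a} {b} Wn Wn+1 = ≈-trans (≡⇒≈ (lemma (W n) (W (suc n)))) (+-cong Wn+1 (*-congˡ (- + 3) Wn))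
    where
    lemma : ∀ x y → y - + 3 * x ≡ y + (- + 3) * x
    lemma = solve-∀

  -- `Z-rec` is run backwards from Z(p+1) = (p+1) X(p) ≡ X(p), which avoids evaluating W(p-2).
  Z[p-1] : Z (2 ℕ.* m) ≈ + 18 * ε + (- + 20) * χ
  Z[p-1] = begin
    Z n
      ≡⟨ lemma₁ (Z n) (W p) (W n) ⟩
    (Z n - + 2 * W p - + 6 * W n) + (+ 2 * W p + + 6 * W n)
      ≡⟨ cong (_+ (+ 2 * W p + + 6 * W n)) (trans (sym (Z-rec n)) (Z-suc p)) ⟩
    + suc p * X p + (+ 2 * W p + + 6 * W n)
      ≡⟨ cong (_+ (+ 2 * W p + + 6 * W n)) (lemma₂ (+ p) (X p)) ⟩
    (X p + + p * X p) + (+ 2 * W p + + 6 * W n)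
      ≈⟨ +-cong (+-cong (X≈ p W[p] W[p+1]) (m*≈0 (X p))) (+-cong (*-congˡ (+ 2) W[p]) (*-congˡ (+ 6) W[p-1])) ⟩
    ((- + 1 + + 4 * χ + (- + 3) * (- + 1)) + + 0) + (+ 2 * (- + 1) + + 6 * (+ 3 * ε - + 4 * χ))
      ≡⟨ lemma₃ ε χ ⟩
    + 18 * ε + (- + 20) * χ ∎
    where
    n = 2 ℕ.* m
    lemma₁ : ∀ z a b → z ≡ (z - + 2 * a - + 6 * b) + (+ 2 * a + + 6 * b)
    lemma₁ = solve-∀
    lemma₂ : ∀ p x → (+ 1 + p) * x ≡ x + p * x
    lemma₂ = solve-∀
    lemma₃ : ∀ e c → ((- + 1 + + 4 * c + (- + 3) * (- + 1)) + + 0) + (+ 2 * (- + 1) + + 6 * (+ 3 * e - + 4 * c))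
                   ≡ + 18 * e + (- + 20) * c
    lemma₃ = solve-∀

  S/p : ∃[ q ] ((S p ≡ + p * q)
    × (q ≡ + 24 + + 10 * legendre (- (+ 1)) p - + 9 * legendre (+ p) 3
         - + 18 * legendre (+ 3) p [mod + p ]))
  -- At n = p-1 the equation for 2q determines q modulo p, as 2 is invertible.
  S/p = let q , S≡ , 2q≡ , _ = S-quotient n in
        q , S≡ , ≈⇒≡[mod] (≈-trans (*-cancelˡ-≈ (+ 2) 2≉0 (≈-trans (≡⇒≈ 2q≡) 2q≈)) legendres)
    where
    n = 2 ℕ.* m
    l₁ = legendre (- (+ 1)) p
    l₂ = legendre (+ p) 3
    l₃ = legendre (+ 3) p
    2q≈ : + 18 * (W n * W n) + X n * Z n ≈ + 2 * (+ 24 + + 10 * χ + (- + 9) * ε + (- + 18) * t)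
    2q≈ = begin
      + 18 * (W n * W n) + X n * Z n
        ≈⟨ +-cong (*-congˡ (+ 18) (*-cong W[p-1] W[p-1])) (*-cong (X≈ n W[p-1] W[p]) Z[p-1]) ⟩
      + 18 * ((+ 3 * ε - + 4 * χ) * (+ 3 * ε - + 4 * χ))
        + (- + 1 + (- + 3) * (+ 3 * ε - + 4 * χ)) * (+ 18 * ε + (- + 20) * χ)
        -- The two ε² terms cancel as 162 - 162, so the formula is uniform in p even though ε² ≡ 0
        -- for p = 3 and ε² ≡ 1 otherwise.
        ≡⟨ lemma₁ ε χ ⟩
      + 48 * (χ * χ) + (- + 36) * (ε * χ) + (- + 18) * ε + + 20 * χ
        ≡⟨ cong₂ (λ a b → + 48 * a + (- + 36) * b + (- + 18) * ε + + 20 * χ) χ²≡1 εχ≡t ⟩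
      + 48 * + 1 + (- + 36) * t + (- + 18) * ε + + 20 * χ
        ≡⟨ lemma₂ ε χ t ⟩
      + 2 * (+ 24 + + 10 * χ + (- + 9) * ε + (- + 18) * t) ∎
      where
      lemma₁ : ∀ e c → + 18 * ((+ 3 * e - + 4 * c) * (+ 3 * e - + 4 * c))
                       + (- + 1 + (- + 3) * (+ 3 * e - + 4 * c)) * (+ 18 * e + (- + 20) * c)
                     ≡ + 48 * (c * c) + (- + 36) * (e * c) + (- + 18) * e + + 20 * c
      lemma₁ = solve-∀
      lemma₂ : ∀ e c t → + 48 * + 1 + (- + 36) * t + (- + 18) * e + + 20 * c
                       ≡ + 2 * (+ 24 + + 10 * c + (- + 9) * e + (- + 18) * t)
      lemma₂ = solve-∀
    legendres : + 24 + + 10 * χ + (- + 9) * ε + (- + 18) * t ≈ + 24 + + 10 * l₁ - + 9 * l₂ - + 18 * l₃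
    legendres = begin
      + 24 + + 10 * χ + (- + 9) * ε + (- + 18) * t
        ≈⟨ +-cong (+-cong (+-congˡ (+ 24) (*-congˡ (+ 10) (euler (- + 1)))) (*-congˡ (- + 9) [-3]^m)) (*-congˡ (- + 18) (euler (+ 3))) ⟩
      + 24 + + 10 * l₁ + (- + 9) * l₂ + (- + 18) * l₃
        ≡⟨ lemma l₁ l₂ l₃ ⟩
      + 24 + + 10 * l₁ - + 9 * l₂ - + 18 * l₃ ∎
      where
      lemma : ∀ c e t → + 24 + + 10 * c + (- + 9) * e + (- + 18) * t ≡ + 24 + + 10 * c - + 9 * e - + 18 * t
      lemma = solve-∀

theorem1p1 : ((n : ℕ) → S (suc n) ≡ + (suc n) [mod + (2 ℕ.* suc n) ])
    × ((p : ℕ) → Prime p → p ≢ 2 →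
    ∃[ q ] ((S p ≡ + p * q)
    × (q ≡ + 24 + + 10 * legendre (- (+ 1)) p - + 9 * legendre (+ p) 3
    - + 18 * legendre (+ 3) p [mod + p ])))
theorem1p1 = S≡n[mod-2n] , λ p pp p≢2 → cases pp p≢2 (parity p)
  where
  cases : ∀ {p} → Prime p → p ≢ 2 → Parity p →
    ∃[ q ] ((S p ≡ + p * q)
    × (q ≡ + 24 + + 10 * legendre (- (+ 1)) p - + 9 * legendre (+ p) 3
    - + 18 * legendre (+ 3) p [mod + p ]))
  cases pp p≢2 (even k) = ⊥-elim ([ (λ ()) , (λ 2≡p → p≢2 (sym 2≡p)) ]′ (prime⇒irreducible pp (ℕDiv.m∣m*n k)))
  cases pp _   (odd m)  = SModPrime.S/p m pp
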